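{- The maps $\psi_V:\mathrm{T}[V]\to\mathrm{T}^{\bullet}[V]$, defined for every tree $t$ on $V$ by $$\psi(t)=\sum_{r\in V}(t,r),$$ form a monomorphism of operads from $\mathrm{T}$ to $\mathrm{PLie}$.
   Context: $\mathbb{K}$ is a field of characteristic $0$. A (linear) species is a functor from finite sets with bijections to $\mathbb{K}$-vector spaces. An operad is a species $O$ with $O[\emptyset]=\{0\}$, units $e(v)\in O[\{v\}]$, and natural bilinear partial compositions $\circ_*:O[V_1\sqcup\{*\}]\times O[V_2]\to O[V_1\sqcup V_2]$ satisfying the usual parallel and sequential associativity axioms and unit axioms of symmetric operads. A morphism of operads is a natural family of linear maps preserving units and partial compositions; it is a monomorphism if all its components are injective. Operad $\mathrm{T}$: $\mathrm{T}[V]$ ($V$ nonempty) has basis the trees with vertex set $V$ (connected acyclic simple graphs). For a tree $t_1$ on $V_1\sqcup\{*\}$ and a tree $t_2$ on $V_2$, $t_1\circ_*t_2$ is the sum of all trees obtained by taking the disjoint union of $t_1$ and $t_2$, removing $*$ and, for each neighbour of $*$ in $t_1$, adding an edge between this neighbour and any vertex of $t_2$ (sum over all independent choices). The units are the one-vertex trees. Operad $\mathrm{PLie}$ (pre-Lie operad): its underlying species is $\mathrm{T}^{\bullet}$, where $\mathrm{T}^{\bullet}[V]$ has basis the rooted trees $(t,r)$, $t$ a tree on $V$, $r\in V$. For rooted trees $t_1$ on $V_1\sqcup\{*\}$ and $t_2$ on $V_2$, $t_1\circ_* t_2$ is the sum over all rooted trees obtained by taking the disjoint union, removing $*$, adding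 an edge between the parent of $*$ in $t_1$ (if any) and the root of $t_2$, and, for each child of $*$ in $t_1$, adding an edge between this child and any vertex of $t_2$ (sum over all independent choices); the root is the root of $t_1$ if it is not $*$, and the root of $t_2$ otherwise. The units are the one-vertex rooted trees. -}

module Defs where

open import Level using (Level; 0ℓ; _⊔_) renaming (suc to lsuc)
open import Algebra.Apartness.Bundles using (HeytingField; HeytingCommutativeRing)
open import Algebra.Bundles using (CommutativeRing)
open import Algebra.Module.Bundles using (Module)
open import Algebra.Module.Morphism.Structures using (module ModuleMorphisms)
import Algebra.Module.Morphism.Construct.Composition as Composition
import Algebra.Properties.Monoid.Mult as Mult
open import Data.Bool.Base using (Bool; true; false; T)
open import Data.Bool.Properties using (T?)
open import Data.Empty using (⊥; ⊥-elim; ⊥-elim-irr)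
open import Data.Fin.Base using (Fin; zero; suc)
open import Data.Fin.Properties using (+↔⊎; inj⇒≟; 0↔⊥; 1↔⊤)
open import Data.List.Base as List using (List; []; _∷_; _∷ʳ_; _++_; length; foldr; concatMap; cartesianProductWith; tabulate)
open import Data.List.Properties using (map-++; ++-assoc; length-++; length-map)
open import Data.List.Relation.Unary.All as All using (All; []; _∷_)
import Data.List.Relation.Unary.All.Properties as AllP
open import Data.List.Relation.Unary.Any as Any using (Any; here; there)
import Data.List.Relation.Unary.Any.Properties as AnyP
open import Data.List.Relation.Unary.AllPairs as AllPairs using (AllPairs; []; _∷_)
import Data.List.Relation.Unary.AllPairs.Properties as AllPairsP
open import Data.List.Relation.Unary.Linked as Linked using (Linked; []; [-]; _∷_)
import Data.List.Relation.Unary.Linked.Properties as LinkedP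
open import Data.List.Relation.Unary.Unique.Propositional using (Unique)
open import Data.Nat.Base using (ℕ; zero; suc; _+_; _≤_; z≤n; s≤s)
open import Data.Product.Base using (_×_; _,_; proj₁; proj₂; Σ-syntax; ∃-syntax)
open import Data.Sum.Base as Sum using (_⊎_; inj₁; inj₂; [_,_])
open import Data.Sum.Algebra using (⊎-cong)
open import Data.Sum.Properties using (inj₁-injective; ≡-dec)
open import Data.Unit.Base using (⊤; tt)
open import Function.Base using (id; _∘_)
open import Function.Bundles using (Inverse; _↔_; mk↔ₛ′)
open import Function.Definitions using (Injective)
open import Function.Construct.Identity using (↔-id)
open import Function.Construct.Symmetry using (↔-sym)
open import Function.Construct.Composition using (_↔-∘_)
open import Function.Properties.Inverse using (↔⇒↣)
open import Relation.Binary.Bundles using (Setoid)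
open import Relation.Binary.Core using (Rel)
open import Relation.Binary.Construct.Closure.ReflexiveTransitive as Star using (Star; ε; _◅_; _◅◅_)
open import Relation.Binary.Definitions using (DecidableEquality)
open import Relation.Binary.PropositionalEquality.Core using (_≡_; _≢_; refl; sym; trans; cong; cong₂; subst; subst₂)
import Relation.Binary.PropositionalEquality.Properties as ≡
open import Relation.Nullary.Negation.Core using (¬_; contradiction)
open import Relation.Nullary.Decidable.Core using (Dec; yes; no; ⌊_⌋; toWitness; fromWitness)
open import Relation.Nullary.Decidable using (_×-dec_; ¬?)

private variable
  a b c m ℓ ℓ₁ ℓ₂ : Level
  A B : Set a

-- Without η, and with the operations below defined by copatterns, V and W can
-- be inferred from V ⊕ W.
record FinSet : Set₁ where
  no-eta-equality
  field
    ∣_∣  : Set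
    size : ℕ
    enum : ∣_∣ ↔ Fin size

  infix 4 _≟_
  _≟_ : DecidableEquality ∣_∣
  _≟_ = inj⇒≟ (↔⇒↣ enum)

  elements : List ∣_∣
  elements = tabulate (Inverse.from enum)

open FinSet public using (∣_∣; elements)

-- A record rather than a synonym of ∣ V ∣ ↔ ∣ W ∣, so that V and W can be
-- inferred.
infix 4 _≅_
record _≅_ (V W : FinSet) : Set where
  constructor ⟪_⟫
  field bijection : ∣ V ∣ ↔ ∣ W ∣
  open Inverse bijection public using (to; from; strictlyInverseˡ; strictlyInverseʳ)

open _≅_ public using (to; from; strictlyInverseˡ; strictlyInverseʳ)

private variable
  U V V′ W W′ Z : FinSet

idᵇ : V ≅ V
idᵇ = ⟪ ↔-id _ ⟫

_⁻¹ : V ≅ W → W ≅ V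
⟪ σ ⟫ ⁻¹ = ⟪ ↔-sym σ ⟫

infixr 9 _∘ᵇ_
_∘ᵇ_ : V ≅ W → U ≅ V → U ≅ W
⟪ σ ⟫ ∘ᵇ ⟪ τ ⟫ = ⟪ σ ↔-∘ τ ⟫

∅ : FinSet
∅ .FinSet.∣_∣  = ⊥
∅ .FinSet.size = 0
∅ .FinSet.enum = ↔-sym 0↔⊥

-- The singleton {*}.
• : FinSet
• .FinSet.∣_∣  = ⊤
• .FinSet.size = 1
• .FinSet.enum = ↔-sym 1↔⊤

infixr 6 _⊕_ _⊕ᵇ_
_⊕_ : FinSet → FinSet → FinSet
(V ⊕ W) .FinSet.∣_∣  = ∣ V ∣ ⊎ ∣ W ∣
(V ⊕ W) .FinSet.size = FinSet.size V + FinSet.size W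
(V ⊕ W) .FinSet.enum = ↔-sym +↔⊎ ↔-∘ ⊎-cong (FinSet.enum V) (FinSet.enum W)

_⊕ᵇ_ : V ≅ V′ → W ≅ W′ → V ⊕ W ≅ V′ ⊕ W′
⟪ σ ⟫ ⊕ᵇ ⟪ τ ⟫ = ⟪ ⊎-cong σ τ ⟫

assocᵇ : (V ⊕ W) ⊕ Z ≅ V ⊕ (W ⊕ Z)
assocᵇ = ⟪ mk↔ₛ′ Sum.assocʳ Sum.assocˡ
  (λ { (inj₁ _) → refl ; (inj₂ (inj₁ _)) → refl ; (inj₂ (inj₂ _)) → refl })
  (λ { (inj₁ (inj₁ _)) → refl ; (inj₁ (inj₂ _)) → refl ; (inj₂ _) → refl }) ⟫

exchange : {A B C : Set} → (A ⊎ B) ⊎ C → (A ⊎ C) ⊎ B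
exchange (inj₁ (inj₁ a)) = inj₁ (inj₁ a)
exchange (inj₁ (inj₂ b)) = inj₂ b
exchange (inj₂ c)        = inj₁ (inj₂ c)

exchange-involutive : {A B C : Set} (x : (A ⊎ B) ⊎ C) → exchange (exchange x) ≡ x
exchange-involutive (inj₁ (inj₁ _)) = refl
exchange-involutive (inj₁ (inj₂ _)) = refl
exchange-involutive (inj₂ _)        = refl

exchangeᵇ : (V ⊕ W) ⊕ Z ≅ (V ⊕ Z) ⊕ W
exchangeᵇ = ⟪ mk↔ₛ′ exchange exchange exchange-involutive exchange-involutive ⟫

identityˡᵇ : ∅ ⊕ V ≅ V
identityˡᵇ = ⟪ mk↔ₛ′ (λ { (inj₁ ()) ; (inj₂ v) → v }) inj₂ (λ _ → refl) (λ { (inj₁ ()) ; (inj₂ _) → refl }) ⟫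

Singleton : FinSet → Set
Singleton V = Σ[ v ∈ ∣ V ∣ ] ∀ w → w ≡ v

singletonᵇ : Singleton V → • ≅ V
singletonᵇ (v , unique) = ⟪ mk↔ₛ′ (λ _ → v) (λ _ → tt) (λ w → sym (unique w)) (λ _ → refl) ⟫

∅⊕•-singleton : Singleton (∅ ⊕ •)
∅⊕•-singleton = inj₂ tt , λ { (inj₁ ()) ; (inj₂ tt) → refl }

-- v ∷ vs is a cycle: at least three distinct vertices, consecutive ones being
-- adjacent, and the last one being adjacent to the first.
record IsCycle {A : Set} (_~_ : Rel A 0ℓ) (v : A) (vs : List A) : Set where
  constructor mkCycle
  field
    length≥3 : 2 ≤ length vs
    distinct : Unique (v ∷ vs)
    closed   : Linked _~_ (v ∷ (vs ∷ʳ v))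

record Tree (V : FinSet) : Set where
  field
    adj : ∣ V ∣ → ∣ V ∣ → Bool

  infix 4 _~_
  _~_ : Rel ∣ V ∣ 0ℓ
  u ~ v = T (adj u v)

  field
    symmetric   : ∀ {u v} → u ~ v → v ~ u
    irreflexive : ∀ {v} → ¬ (v ~ v)
    nonempty    : ∣ V ∣  -- so that T[∅] = 0; the equality below ignores the choice
    connected   : ∀ u v → Star _~_ u v
    acyclic     : ∀ {v vs} → ¬ IsCycle _~_ v vs

open Tree using (adj; nonempty)

infix 4 _≈ᵀ_
_≈ᵀ_ : Rel (Tree V) 0ℓ
s ≈ᵀ t = ∀ u v → adj s u v ≡ adj t u v

record RootedTree (V : FinSet) : Set where
  constructor rooted
  field
    tree : Tree V
    root : ∣ V ∣

open RootedTree using (tree; root)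

infix 4 _≈ᴿ_
_≈ᴿ_ : Rel (RootedTree V) 0ℓ
s ≈ᴿ t = tree s ≈ᵀ tree t × root s ≡ root t

treeSetoid : FinSet → Setoid 0ℓ 0ℓ
treeSetoid V = record
  { Carrier = Tree V ; _≈_ = _≈ᵀ_
  ; isEquivalence = record
    { refl = λ _ _ → refl ; sym = λ p u v → sym (p u v) ; trans = λ p q u v → trans (p u v) (q u v) }
  }

rootedTreeSetoid : FinSet → Setoid 0ℓ 0ℓ
rootedTreeSetoid V = record
  { Carrier = RootedTree V ; _≈_ = _≈ᴿ_
  ; isEquivalence = record
    { refl  = (λ _ _ → refl) , refl
    ; sym   = λ (p , r) → (λ u v → sym (p u v)) , sym r
    ; trans = λ (p , r) (q , s) → (λ u v → trans (p u v) (q u v)) , trans r s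
    }
  }

module _ {A B : Set} {_~_ : Rel A 0ℓ} {_≈_ : Rel B 0ℓ} (h : A → B) where

  private
    map-closed : ∀ v vs → List.map h (v ∷ (vs ∷ʳ v)) ≡ h v ∷ (List.map h vs ∷ʳ h v)
    map-closed v vs = cong (h v ∷_) (map-++ h vs (v ∷ []))

  cycle-map⁺ : Injective _≡_ _≡_ h → (∀ {a b} → a ~ b → h a ≈ h b) →
               ∀ {v vs} → IsCycle _~_ v vs → IsCycle _≈_ (h v) (List.map h vs)
  cycle-map⁺ inj hom {v} {vs} (mkCycle l d c) = mkCycle
    (subst (2 ≤_) (sym (length-map h vs)) l)
    (AllPairsP.map⁺ (AllPairs.map (λ a≢b ha≡hb → a≢b (inj ha≡hb)) d))
    (subst (Linked _≈_) (map-closed v vs) (LinkedP.map⁺ (Linked.map hom c)))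

  cycle-map⁻ : (∀ {a b} → h a ≈ h b → a ~ b) →
               ∀ {v vs} → IsCycle _≈_ (h v) (List.map h vs) → IsCycle _~_ v vs
  cycle-map⁻ refl-h {v} {vs} (mkCycle l d c) = mkCycle
    (subst (2 ≤_) (length-map h vs) l)
    (AllPairs.map (λ ha≢hb a≡b → ha≢hb (cong h a≡b)) (AllPairsP.map⁻ d))
    (Linked.map refl-h (LinkedP.map⁻ (subst (Linked _≈_) (sym (map-closed v vs)) c)))

linked-∷ʳ : {A : Set} {_~_ : Rel A 0ℓ} {x y : A} → ∀ v vs →
            Linked _~_ (v ∷ (vs ∷ʳ x)) → x ~ y → Linked _~_ (v ∷ ((vs ∷ʳ x) ∷ʳ y))
linked-∷ʳ v []       (p ∷ [-]) q = p ∷ q ∷ [-]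
linked-∷ʳ v (w ∷ vs) (p ∷ ps)  q = p ∷ linked-∷ʳ w vs ps q

unique-∷ʳ : {A : Set} {x : A} → ∀ {vs} → All (x ≢_) vs → Unique vs → Unique (vs ∷ʳ x)
unique-∷ʳ []       []       = [] ∷ []
unique-∷ʳ (p ∷ ps) (q ∷ qs) = AllP.∷ʳ⁺ q (p ∘ sym) ∷ unique-∷ʳ ps qs

module _ {A : Set} {_~_ : Rel A 0ℓ} where

  rotate₁ : ∀ {v w vs} → IsCycle _~_ v (w ∷ vs) → IsCycle _~_ w (vs ∷ʳ v)
  rotate₁ {v} {w} {vs} (mkCycle l (p ∷ ps) (e ∷ c)) = mkCycle
    (subst (2 ≤_) (trans (1+n≡n+1 (length vs)) (sym (length-++ vs))) l)
    (unique-∷ʳ p ps)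
    (linked-∷ʳ w vs c e)
    where
    1+n≡n+1 : ∀ n → suc n ≡ n + 1
    1+n≡n+1 zero    = refl
    1+n≡n+1 (suc n) = cong suc (1+n≡n+1 n)

  rotate : ∀ v us {w ws} → IsCycle _~_ v (us ++ w ∷ ws) → IsCycle _~_ w (ws ++ v ∷ us)
  rotate v []       c = rotate₁ c
  rotate v (u ∷ us) {w} {ws} c = subst (IsCycle _~_ w) (++-assoc ws (v ∷ []) (u ∷ us))
    (rotate u us (subst (IsCycle _~_ u) (++-assoc us (w ∷ ws) (v ∷ [])) (rotate₁ c)))

data Path {A : Set} (_~_ : Rel A 0ℓ) (u : A) : List A → A → Set where
  []  : Path _~_ u [] u
  _∷_ : ∀ {v vs w} → u ~ v → Path _~_ v vs w → Path _~_ u (v ∷ vs) w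

module _ {A : Set} (_≟′_ : DecidableEquality A) {_~_ : Rel A 0ℓ} where

  path-linked : ∀ {u vs w x} → Path _~_ u vs w → w ~ x → Linked _~_ (u ∷ (vs ∷ʳ x))
  path-linked []      q = q ∷ [-]
  path-linked (e ∷ p) q = e ∷ path-linked p q

  suffix : ∀ {u v vs w} → Any (u ≡_) (v ∷ vs) → Path _~_ v vs w → Unique (v ∷ vs) →
           ∃[ us ] Path _~_ u us w × Unique (u ∷ us)
  suffix (here refl) p       d       = _ , p , d
  suffix (there i)   (_ ∷ p) (_ ∷ d) = suffix i p d

  simplify : ∀ {u w} → Star _~_ u w → ∃[ vs ] Path _~_ u vs w × Unique (u ∷ vs)
  simplify ε = [] , [] , [] ∷ []
  simplify {u} (_◅_ {j = v} e es) with simplify es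
  ... | vs , p , d with Any.any? (u ≟′_) (v ∷ vs)
  ... | yes i = suffix i p d
  ... | no ¬i = v ∷ vs , e ∷ p , AllP.¬Any⇒All¬ (v ∷ vs) ¬i ∷ d

relabel : V ≅ W → Tree V → Tree W
relabel σ t = record
  { adj         = λ u v → adj t (from σ u) (from σ v)
  ; symmetric   = Tree.symmetric t
  ; irreflexive = Tree.irreflexive t
  ; nonempty    = to σ (nonempty t)
  ; connected   = λ u v → subst₂ (Star _~′_) (strictlyInverseˡ σ u) (strictlyInverseˡ σ v)
      (Star.gmap (to σ) to-hom (Tree.connected t (from σ u) (from σ v)))
  ; acyclic     = λ c → Tree.acyclic t (cycle-map⁺ (from σ) from-injective id c)
  }
  where
  _~′_ : Rel _ 0ℓ
  u ~′ v = T (adj t (from σ u) (from σ v))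
  to-hom : ∀ {x y} → T (adj t x y) → to σ x ~′ to σ y
  to-hom {x} {y} = subst T (cong₂ (adj t) (sym (strictlyInverseʳ σ x)) (sym (strictlyInverseʳ σ y)))
  from-injective : Injective _≡_ _≡_ (from σ)
  from-injective p = trans (sym (strictlyInverseˡ σ _)) (trans (cong (to σ) p) (strictlyInverseˡ σ _))

relabelᴿ : V ≅ W → RootedTree V → RootedTree W
relabelᴿ σ (rooted t r) = rooted (relabel σ t) (to σ r)

vertex : ∀ V → Singleton V → Tree V
vertex V (v , unique) = record
  { adj         = λ _ _ → false
  ; symmetric   = λ ()
  ; irreflexive = λ ()
  ; nonempty    = v
  ; connected   = λ u w → subst (Star _ u) (trans (unique u) (sym (unique w))) ε
  ; acyclic     = λ { (mkCycle l ((p ∷ _) ∷ _) _) → p (trans (unique _) (sym (unique _))) }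
  }

vertexᴿ : ∀ V → Singleton V → RootedTree V
vertexᴿ V s = rooted (vertex V s) (proj₁ s)

-- One vertex of W for each neighbour of * in t.  Irrelevance makes the vertex
-- depend on the neighbour only, and not on the proof that it is a neighbour.
Attachment : Tree (V ⊕ •) → FinSet → Set
Attachment t W = ∀ u → .(T (adj t (inj₁ u) (inj₂ tt))) → ∣ W ∣

attached : ∀ W b → (.(T b) → ∣ W ∣) → ∣ W ∣ → Bool
attached W true  f w = ⌊ FinSet._≟_ W (f tt) w ⌋
attached W false f w = false

attached⁺ : ∀ W b (f : .(T b) → ∣ W ∣) {w} (p : T b) → f p ≡ w → T (attached W b f w)
attached⁺ W true f p q = fromWitness q

attached⁻ : ∀ W b (f : .(T b) → ∣ W ∣) {w} → T (attached W b f w) → Σ[ p ∈ T b ] f p ≡ w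
attached⁻ W true f p = tt , toWitness p

graftAdj : (t₁ : Tree (V ⊕ •)) (t₂ : Tree W) → Attachment t₁ W →
           ∣ V ⊕ W ∣ → ∣ V ⊕ W ∣ → Bool
graftAdj         t₁ t₂ f (inj₁ u) (inj₁ v) = adj t₁ (inj₁ u) (inj₁ v)
graftAdj {W = W} t₁ t₂ f (inj₁ u) (inj₂ w) = attached W (adj t₁ (inj₁ u) (inj₂ tt)) (f u) w
graftAdj {W = W} t₁ t₂ f (inj₂ w) (inj₁ u) = attached W (adj t₁ (inj₁ u) (inj₂ tt)) (f u) w
graftAdj         t₁ t₂ f (inj₂ w) (inj₂ z) = adj t₂ w z

module Graft {V W} (t₁ : Tree (V ⊕ •)) (t₂ : Tree W) (f : Attachment t₁ W) where

  private
    module t₁ = Tree t₁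
    module t₂ = Tree t₂

  infix 4 _~_
  _~_ : Rel ∣ V ⊕ W ∣ 0ℓ
  x ~ y = T (graftAdj t₁ t₂ f x y)

  cross⁺ : ∀ {u w} (p : inj₁ u t₁.~ inj₂ tt) → f u p ≡ w → inj₁ u ~ inj₂ w
  cross⁺ {u} = attached⁺ W (adj t₁ (inj₁ u) (inj₂ tt)) (f u)

  cross⁻ : ∀ {u w} → inj₁ u ~ inj₂ w → Σ[ p ∈ inj₁ u t₁.~ inj₂ tt ] f u p ≡ w
  cross⁻ {u} = attached⁻ W (adj t₁ (inj₁ u) (inj₂ tt)) (f u)

  symmetric : ∀ {x y} → x ~ y → y ~ x
  symmetric {inj₁ _} {inj₁ _} = t₁.symmetric
  symmetric {inj₁ _} {inj₂ _} = id
  symmetric {inj₂ _} {inj₁ _} = id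
  symmetric {inj₂ _} {inj₂ _} = t₂.symmetric

  irreflexive : ∀ {x} → ¬ (x ~ x)
  irreflexive {inj₁ _} = t₁.irreflexive
  irreflexive {inj₂ _} = t₂.irreflexive

  private
    descend : ∀ u → Star t₁._~_ (inj₁ u) (inj₂ tt) → ∃[ w ] Star _~_ (inj₁ u) (inj₂ w)
    descend u (_◅_ {j = inj₁ v} e es) with descend v es
    ... | w , p = w , e ◅ p
    descend u (_◅_ {j = inj₂ _} e es) = f u e , cross⁺ e refl ◅ ε

    w₀ : ∣ W ∣
    w₀ = nonempty t₂

    within : ∀ w z → Star _~_ (inj₂ w) (inj₂ z)
    within w z = Star.gmap inj₂ id (t₂.connected w z)

    hub : ∀ x → Star _~_ x (inj₂ w₀)
    hub (inj₁ u) with descend u (t₁.connected (inj₁ u) (inj₂ tt))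
    ... | w , p = p ◅◅ within w w₀
    hub (inj₂ w) = within w w₀

  connected : ∀ x y → Star _~_ x y
  connected x y = hub x ◅◅ Star.reverse (λ {i} {j} → symmetric {i} {j}) (hub y)

  private
    -- The part, up to the next vertex of W, of a simple path leaving W.
    excursion : ∀ u xs e → Linked _~_ (inj₁ u ∷ (xs ∷ʳ inj₂ e)) → Unique (inj₁ u ∷ xs) →
                ∃[ us ] Linked t₁._~_ (inj₁ u ∷ (List.map inj₁ us ∷ʳ inj₂ tt)) × Unique (u ∷ us)
                        × (∀ {a} → All (inj₁ a ≢_) xs → All (a ≢_) us)
    excursion u []            e (p ∷ _) d = [] , proj₁ (cross⁻ p) ∷ [-] , [] ∷ [] , λ _ → []
    excursion u (inj₂ b ∷ xs) e (p ∷ _) d = [] , proj₁ (cross⁻ p) ∷ [-] , [] ∷ [] , λ _ → []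
    excursion u (inj₁ v ∷ xs) e (p ∷ l) ((q ∷ qs) ∷ d) with excursion v xs e l d
    ... | us , l′ , d′ , avoid = v ∷ us , p ∷ l′ , ((q ∘ cong inj₁) ∷ avoid qs) ∷ d′
                                , λ { (r ∷ rs) → (r ∘ cong inj₁) ∷ avoid rs }

    scan : ∀ b xs e → Linked _~_ (inj₂ b ∷ (xs ∷ʳ inj₂ e)) → Unique (inj₂ b ∷ xs) →
           (∃[ bs ] xs ≡ List.map inj₂ bs) ⊎ length xs ≡ 1 ⊎ Any (inj₂ e ≡_) xs
    scan b []            e l       d       = inj₁ ([] , refl)
    scan b (inj₂ v ∷ xs) e (p ∷ l) (q ∷ d) with scan v xs e l d
    ... | inj₁ (bs , eq)     = inj₁ (v ∷ bs , cong (inj₂ v ∷_) eq)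
    ... | inj₂ (inj₂ i)      = inj₂ (inj₂ (there i))
    scan b (inj₂ v ∷ inj₁ u ∷ [])     e (p ∷ q ∷ r ∷ [-]) d | inj₂ (inj₁ _)
      with cross⁻ q | cross⁻ r
    ... | _ , q′ | _ , r′ = inj₂ (inj₂ (here (cong inj₂ (trans (sym r′) q′))))
    scan b (inj₂ v ∷ inj₂ u ∷ [])     e (p ∷ l) (_ ∷ d) | inj₂ (inj₁ _)
      = inj₁ (v ∷ u ∷ [] , refl)
    scan b (inj₁ u ∷ [])              e l       d       = inj₂ (inj₁ refl)
    scan b (inj₁ u ∷ inj₂ v ∷ xs)     e (p ∷ q ∷ l) ((_ ∷ r ∷ _) ∷ d)
      with cross⁻ p | cross⁻ q
    ... | _ , p′ | _ , q′ = contradiction (cong inj₂ (trans (sym p′) q′)) r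
    scan b (inj₁ u ∷ inj₁ v ∷ xs) e (p ∷ q ∷ l) (_ ∷ ((r ∷ rs) ∷ d)) with excursion v xs e l d
    ... | us , l′ , d′ , avoid = ⊥-elim (t₁.acyclic {inj₂ tt} {inj₁ u ∷ inj₁ v ∷ List.map inj₁ us} (mkCycle
      (s≤s (s≤s z≤n))
      (AllP.map⁺ (All.universal (λ _ ()) (u ∷ v ∷ us))
        ∷ AllPairsP.map⁺ {f = inj₁} (AllPairs.map (λ a≢b → a≢b ∘ inj₁-injective) (((r ∘ cong inj₁) ∷ avoid rs) ∷ d′)))
      (t₁.symmetric (proj₁ (cross⁻ p)) ∷ q ∷ l′)))

    acyclic₂ : ∀ {b xs} → ¬ IsCycle _~_ (inj₂ b) xs
    acyclic₂ {b} {xs} cyc@(mkCycle l d c) with scan b xs b c d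
    ... | inj₁ (bs , refl)  = t₂.acyclic (cycle-map⁻ inj₂ id cyc)
    ... | inj₂ (inj₂ i)     = AllP.All¬⇒¬Any (AllPairs.head d) i
    acyclic₂ {b} {_ ∷ []} (mkCycle (s≤s ()) d c) | inj₂ (inj₁ _)

    firstW : (xs : List ∣ V ⊕ W ∣) →
             (∃[ us ] xs ≡ List.map inj₁ us) ⊎ (∃[ as ] ∃[ b ] ∃[ bs ] xs ≡ as ++ inj₂ b ∷ bs)
    firstW []            = inj₁ ([] , refl)
    firstW (inj₂ b ∷ xs) = inj₂ ([] , b , xs , refl)
    firstW (inj₁ u ∷ xs) with firstW xs
    ... | inj₁ (us , eq)          = inj₁ (u ∷ us , cong (inj₁ u ∷_) eq)
    ... | inj₂ (as , b , bs , eq) = inj₂ (inj₁ u ∷ as , b , bs , cong (inj₁ u ∷_) eq)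

  acyclic : ∀ {x xs} → ¬ IsCycle _~_ x xs
  acyclic {inj₂ b} = acyclic₂
  acyclic {inj₁ u} {xs} cyc with firstW xs
  ... | inj₁ (us , refl)          = t₁.acyclic
      (cycle-map⁺ inj₁ inj₁-injective id (cycle-map⁻ {_~_ = λ a b → inj₁ a t₁.~ inj₁ b} inj₁ id cyc))
  ... | inj₂ (as , b , bs , refl) = acyclic₂ (rotate (inj₁ u) as cyc)

graft : (t₁ : Tree (V ⊕ •)) (t₂ : Tree W) → Attachment t₁ W → Tree (V ⊕ W)
graft t₁ t₂ f = record
  { adj         = graftAdj t₁ t₂ f
  ; symmetric   = λ {x} {y} → symmetric {x} {y}
  ; irreflexive = λ {x} → irreflexive {x}
  ; nonempty    = inj₂ (nonempty t₂)
  ; connected   = connected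
  ; acyclic     = acyclic
  }
  where open Graft t₁ t₂ f

functions : ∀ n {B : Fin n → Set} → (∀ i → List (B i)) → List (∀ i → B i)
functions zero    bs = (λ ()) ∷ []
functions (suc n) bs =
  cartesianProductWith (λ b f → λ { zero → b ; (suc i) → f i }) (bs zero) (functions n (bs ∘ suc))

optional : {P B : Set} → Dec P → List B → List (.P → B)
optional (yes _) bs = List.map (λ b _ → b) bs
optional (no ¬p) bs = (λ p → ⊥-elim-irr (¬p p)) ∷ []

-- All families of vertices of W indexed by the vertices of V that satisfy P.
assignments : ∀ V {P : ∣ V ∣ → Set} → (∀ u → Dec (P u)) → ∀ W → List (∀ u → .(P u) → ∣ W ∣)
assignments V {P} P? W = List.map
  (λ f u p → f (Inverse.to enum u) (subst P (sym (Inverse.strictlyInverseʳ enum u)) p))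
  (functions size (λ i → optional (P? (Inverse.from enum i)) (elements W)))
  where open FinSet V using (enum; size)

infix 4 _≐_
_≐_ : {A B : Set} {P : A → Set} → Rel (∀ a → .(P a) → B) 0ℓ
_≐_ {P = P} f g = ∀ a .(p : P a) → f a p ≡ g a p

module _ (n : ℕ) where

  functions-complete : ∀ {B : Fin n → Set} (_~_ : ∀ {i} → Rel (B i) 0ℓ) {bs : ∀ i → List (B i)} (g : ∀ i → B i) →
                       (∀ i → Any (g i ~_) (bs i)) → Any (λ f → ∀ i → g i ~ f i) (functions n bs)
  functions-complete = go n
    where
    go : ∀ n {B : Fin n → Set} (_~_ : ∀ {i} → Rel (B i) 0ℓ) {bs : ∀ i → List (B i)} (g : ∀ i → B i) →
         (∀ i → Any (g i ~_) (bs i)) → Any (λ f → ∀ i → g i ~ f i) (functions n bs)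
    go zero    _~_ g g∈ = here λ ()
    go (suc n) _~_ g g∈ = AnyP.cartesianProductWith⁺ _ (λ p q → λ { zero → p ; (suc i) → q i })
                            (g∈ zero) (go n _~_ (g ∘ suc) (g∈ ∘ suc))

  functions-unique : ∀ {B : Fin n → Set} (_~_ : ∀ {i} → Rel (B i) 0ℓ) {bs : ∀ i → List (B i)} →
                     (∀ i → AllPairs (λ b b′ → ¬ (b ~ b′)) (bs i)) →
                     AllPairs (λ f f′ → ¬ (∀ i → f i ~ f′ i)) (functions n bs)
  functions-unique = go n
    where
    product : ∀ {A B C : Set} (_~₁_ : Rel A 0ℓ) (_~₂_ : Rel B 0ℓ) (_~₃_ : Rel C 0ℓ) (h : A → B → C) →
              (∀ {a a′ b b′} → h a b ~₃ h a′ b′ → a ~₁ a′ × b ~₂ b′) → ∀ {xs ys} →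
              AllPairs (λ b b′ → ¬ (b ~₁ b′)) xs → AllPairs (λ b b′ → ¬ (b ~₂ b′)) ys →
              AllPairs (λ b b′ → ¬ (b ~₃ b′)) (cartesianProductWith h xs ys)
    product _~₁_ _~₂_ _~₃_ h inj []       qs = []
    product _~₁_ _~₂_ _~₃_ h inj {xs = x ∷ xs} {ys} (p ∷ ps) qs = AllPairsP.++⁺
      (AllPairsP.map⁺ (AllPairs.map (λ b≁b′ e → b≁b′ (proj₂ (inj e))) qs))
      (product _~₁_ _~₂_ _~₃_ h inj ps qs)
      (AllP.map⁺ (All.universal (λ y → distinct p y) ys))
      where
      distinct : ∀ {xs′} → All (λ b → ¬ (x ~₁ b)) xs′ → ∀ y →
                 All (λ c → ¬ (h x y ~₃ c)) (cartesianProductWith h xs′ ys)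
      distinct []       y = []
      distinct (r ∷ rs) y = AllP.++⁺ (AllP.map⁺ (All.universal (λ _ e → r (proj₁ (inj e))) ys)) (distinct rs y)

    go : ∀ n {B : Fin n → Set} (_~_ : ∀ {i} → Rel (B i) 0ℓ) {bs : ∀ i → List (B i)} →
         (∀ i → AllPairs (λ b b′ → ¬ (b ~ b′)) (bs i)) →
         AllPairs (λ f f′ → ¬ (∀ i → f i ~ f′ i)) (functions n bs)
    go zero    _~_ u = [] ∷ []
    go (suc n) _~_ u = product _~_ (λ f f′ → ∀ i → f i ~ f′ i) (λ f f′ → ∀ i → f i ~ f′ i) _
                         (λ e → e zero , e ∘ suc) (u zero) (go n _~_ (u ∘ suc))

elements-complete : ∀ V (v : ∣ V ∣) → Any (v ≡_) (elements V)
elements-complete V v = AnyP.tabulate⁺ (Inverse.to enum v) (sym (Inverse.strictlyInverseʳ enum v))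
  where open FinSet V using (enum)

elements-unique : ∀ V → Unique (elements V)
elements-unique V = AllPairsP.tabulate⁺ λ i≢j e → i≢j
  (trans (sym (Inverse.strictlyInverseˡ enum _)) (trans (cong (Inverse.to enum) e) (Inverse.strictlyInverseˡ enum _)))
  where open FinSet V using (enum)

module _ (V : FinSet) {P : ∣ V ∣ → Set} (P? : ∀ u → Dec (P u)) (W : FinSet) where

  private
    open FinSet V using (enum; size)
    Q : Fin size → Set
    Q i = P (Inverse.from enum i)
    _~_ : ∀ {i} → Rel (.(Q i) → ∣ W ∣) 0ℓ
    _~_ {i} f g = .(q : Q i) → f q ≡ g q

    optional-complete : ∀ {Q : Set} (d : Dec Q) (g : .Q → ∣ W ∣) →
                        Any (λ f → .(q : Q) → g q ≡ f q) (optional d (elements W))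
    optional-complete (yes q) g = AnyP.map⁺ (Any.map (λ e .q₁ → e) (elements-complete W (g q)))
    optional-complete (no ¬q) g = here λ q → ⊥-elim-irr (¬q q)

    optional-unique : ∀ {Q : Set} (d : Dec Q) →
                      AllPairs (λ f g → ¬ (.(q : Q) → f q ≡ g q)) (optional d (elements W))
    optional-unique (yes q) = AllPairsP.map⁺ (AllPairs.map (λ a≢b e → a≢b (e q)) (elements-unique W))
    optional-unique (no ¬q) = [] ∷ []

    move : ∀ (f : ∀ u → .(P u) → ∣ W ∣) {u v} → u ≡ v → .(p : P u) .(q : P v) → f u p ≡ f v q
    move f refl _ _ = refl

  assignments-complete : (g : ∀ u → .(P u) → ∣ W ∣) → Any (g ≐_) (assignments V P? W)
  assignments-complete g = AnyP.map⁺ (Any.map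
    (λ e u .p → trans (move g (sym (Inverse.strictlyInverseʳ enum u)) p _) (e (Inverse.to enum u) _))
    (functions-complete size {B = λ i → .(Q i) → ∣ W ∣} _~_ (λ i q → g (Inverse.from enum i) q)
      (λ i → optional-complete (P? (Inverse.from enum i)) _)))

  assignments-unique : AllPairs (λ f g → ¬ (f ≐ g)) (assignments V P? W)
  assignments-unique = AllPairsP.map⁺ (AllPairs.map
    (λ f≁g e → f≁g λ i .q → back e i q)
    (functions-unique size {B = λ i → .(Q i) → ∣ W ∣} _~_ (λ i → optional-unique (P? (Inverse.from enum i)))))
    where
    back : ∀ {f g : ∀ i → .(Q i) → ∣ W ∣} →
           (∀ u .(p : P u) → f (Inverse.to enum u) (subst P (sym (Inverse.strictlyInverseʳ enum u)) p)
                           ≡ g (Inverse.to enum u) (subst P (sym (Inverse.strictlyInverseʳ enum u)) p)) →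
           ∀ i .(q : Q i) → f i q ≡ g i q
    back {f} {g} e i q = reindex (Inverse.strictlyInverseˡ enum i) (e (Inverse.from enum i) q)
      where
      reindex : ∀ {j} .{q′ : Q j} .{q : Q i} → j ≡ i → f j q′ ≡ g j q′ → f i q ≡ g i q
      reindex refl e = e

-- u is the parent of * in the tree t rooted at r: it is adjacent to *, and it
-- is joined to r by a walk that avoids *.
Parent : Tree (V ⊕ •) → ∣ V ⊕ • ∣ → ∣ V ∣ → Set
Parent t (inj₁ r) u = T (adj t (inj₁ u) (inj₂ tt)) × Star (λ v w → T (adj t (inj₁ v) (inj₁ w))) u r
Parent t (inj₂ _) u = ⊥

module _ {V} (t : Tree (V ⊕ •)) where

  private
    open Tree t using (_~_; symmetric; connected; acyclic)
    _~₁_ : Rel ∣ V ∣ 0ℓ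
    u ~₁ v = inj₁ u ~ inj₁ v

    leave : ∀ {x r} → Star _~_ x (inj₁ r) →
            (∃[ u ] Parent t (inj₁ r) u) ⊎ (∃[ u ] x ≡ inj₁ u × Star _~₁_ u r)
    leave ε = inj₂ (_ , refl , ε)
    leave {x} (e ◅ es) with leave es
    ... | inj₁ found = inj₁ found
    leave {inj₁ v} (e ◅ es) | inj₂ (u , refl , p) = inj₂ (v , refl , e ◅ p)
    leave {inj₂ _} (e ◅ es) | inj₂ (u , refl , p) = inj₁ (u , symmetric e , p)

  parent-exists : ∀ r → ∃[ u ] Parent t (inj₁ r) u
  parent-exists r with leave (connected (inj₂ tt) (inj₁ r))
  ... | inj₁ found = found

  parent-adjacent : ∀ r {u} → Parent t r u → inj₁ u ~ inj₂ tt
  parent-adjacent (inj₁ r) = proj₁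

  parent-unique : ∀ r {u v} → Parent t r u → Parent t r v → u ≡ v
  parent-unique (inj₁ r) {u} {v} (eᵤ , p) (eᵥ , q)
    with simplify (FinSet._≟_ V) (p ◅◅ Star.reverse symmetric q)
  ... | []     , []       , d = refl
  ... | w ∷ ws , path     , d = ⊥-elim (acyclic {inj₂ tt} {inj₁ u ∷ inj₁ w ∷ List.map inj₁ ws} (mkCycle
    (s≤s (s≤s z≤n))
    (AllP.map⁺ (All.universal (λ _ ()) (u ∷ w ∷ ws))
      ∷ AllPairsP.map⁺ {f = inj₁} (AllPairs.map (λ a≢b → a≢b ∘ inj₁-injective) d))
    (symmetric eᵤ ∷ path-linked (≡-dec (FinSet._≟_ V) (λ _ _ → yes refl)) (lift path) eᵥ)))
    where
    lift : ∀ {u vs w} → Path _~₁_ u vs w → Path _~_ (inj₁ u) (List.map inj₁ vs) (inj₁ w)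
    lift []      = []
    lift (e ∷ p) = e ∷ lift p

  parent? : ∀ r u → Dec (Parent t r u)
  parent? (inj₂ _) u = no λ ()
  parent? (inj₁ r) u with parent-exists r
  ... | v , p with FinSet._≟_ V u v
  ... | yes refl = yes p
  ... | no u≢v   = no λ q → u≢v (parent-unique (inj₁ r) q p)

  Child : ∣ V ⊕ • ∣ → ∣ V ∣ → Set
  Child r u = T (adj t (inj₁ u) (inj₂ tt)) × ¬ Parent t r u

  child? : ∀ r u → Dec (Child r u)
  child? r u = T? (adj t (inj₁ u) (inj₂ tt)) ×-dec ¬? (parent? r u)

infixl 7 _∘ᵀ_ _∘ᴿ_
_∘ᵀ_ : Tree (V ⊕ •) → Tree W → List (Tree (V ⊕ W))
_∘ᵀ_ {V} {W} t₁ t₂ = List.map (graft t₁ t₂)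
  (assignments V (λ u → T? (adj t₁ (inj₁ u) (inj₂ tt))) W)

withParent : (t : Tree (V ⊕ •)) (r : ∣ V ⊕ • ∣) → ∣ W ∣ → (∀ u → .(Child t r u) → ∣ W ∣) → Attachment t W
withParent t r r₂ f u p with parent? t r u
... | yes _ = r₂
... | no ¬q = f u (p , ¬q)

graftRoot : {A B : Set} → A ⊎ ⊤ → B → A ⊎ B
graftRoot (inj₁ r₁) r₂ = inj₁ r₁
graftRoot (inj₂ _)  r₂ = inj₂ r₂

_∘ᴿ_ : RootedTree (V ⊕ •) → RootedTree W → List (RootedTree (V ⊕ W))
_∘ᴿ_ {V} {W} (rooted t₁ r₁) (rooted t₂ r₂) = List.map
  (λ f → rooted (graft t₁ t₂ (withParent {W = W} t₁ r₁ r₂ f)) (graftRoot r₁ r₂))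
  (assignments V (child? t₁ r₁) W)

T-ext : ∀ {b b′} → (T b → T b′) → (T b′ → T b) → b ≡ b′
T-ext {false} {false} f g = refl
T-ext {false} {true}  f g = ⊥-elim (g tt)
T-ext {true}  {false} f g = ⊥-elim (f tt)
T-ext {true}  {true}  f g = refl

T-irrelevant : ∀ {b} → .(T b) → T b
T-irrelevant {true} _ = tt

adj-sym : (t : Tree V) → ∀ u v → adj t u v ≡ adj t v u
adj-sym t u v = T-ext (Tree.symmetric t) (Tree.symmetric t)

adj-irrefl : (t : Tree V) → ∀ v → adj t v v ≡ false
adj-irrefl t v with adj t v v | Tree.irreflexive t {v}
... | false | _ = refl
... | true  | p = ⊥-elim (p tt)

tree-ext : (s t : Tree (V ⊕ W)) →
           (∀ u v → adj s (inj₁ u) (inj₁ v) ≡ adj t (inj₁ u) (inj₁ v)) →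
           (∀ u w → adj s (inj₁ u) (inj₂ w) ≡ adj t (inj₁ u) (inj₂ w)) →
           (∀ w z → adj s (inj₂ w) (inj₂ z) ≡ adj t (inj₂ w) (inj₂ z)) → s ≈ᵀ t
tree-ext s t p q r (inj₁ u) (inj₁ v) = p u v
tree-ext s t p q r (inj₁ u) (inj₂ w) = q u w
tree-ext s t p q r (inj₂ w) (inj₁ u) = trans (adj-sym s _ _) (trans (q u w) (adj-sym t _ _))
tree-ext s t p q r (inj₂ w) (inj₂ z) = r w z

≈ᵀ-sym : {s t : Tree V} → s ≈ᵀ t → t ≈ᵀ s
≈ᵀ-sym p u v = sym (p u v)

≈ᵀ-trans : {s t r : Tree V} → s ≈ᵀ t → t ≈ᵀ r → s ≈ᵀ r
≈ᵀ-trans p q u v = trans (p u v) (q u v)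

attached-cong : ∀ W {b} {f g : .(T b) → ∣ W ∣} → (.(p : T b) → f p ≡ g p) →
                ∀ w → attached W b f w ≡ attached W b g w
attached-cong W {true}  e w = cong (λ x → ⌊ FinSet._≟_ W x w ⌋) (e tt)
attached-cong W {false} e w = refl

graft-cong : (t₁ : Tree (V ⊕ •)) (t₂ : Tree W) {f g : Attachment t₁ W} → f ≐ g → graft t₁ t₂ f ≈ᵀ graft t₁ t₂ g
graft-cong {W = W} t₁ t₂ {f} {g} e = tree-ext (graft t₁ t₂ f) (graft t₁ t₂ g)
  (λ _ _ → refl) (λ u w → attached-cong W (e u) w) (λ _ _ → refl)

∈ᵀ⁺ : (t₁ : Tree (V ⊕ •)) (t₂ : Tree W) {t : Tree (V ⊕ W)} →
      (f : Attachment t₁ W) → t ≈ᵀ graft t₁ t₂ f → Any (t ≈ᵀ_) (t₁ ∘ᵀ t₂)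
∈ᵀ⁺ {V} {W} t₁ t₂ {t} f e = AnyP.map⁺ (Any.map
  (λ {g} f≐g → ≈ᵀ-trans {s = t} {graft t₁ t₂ f} {graft t₁ t₂ g} e (graft-cong t₁ t₂ f≐g))
  (assignments-complete V (λ u → T? (adj t₁ (inj₁ u) (inj₂ tt))) W f))

∈ᵀ⁻ : (t₁ : Tree (V ⊕ •)) (t₂ : Tree W) {t : Tree (V ⊕ W)} →
      Any (t ≈ᵀ_) (t₁ ∘ᵀ t₂) → Σ[ f ∈ Attachment t₁ W ] t ≈ᵀ graft t₁ t₂ f
∈ᵀ⁻ t₁ t₂ i = Any.satisfied (AnyP.map⁻ i)

module _ {V W} {t₁ t₁′ : Tree (V ⊕ •)} {t₂ t₂′ : Tree W} {f : Attachment t₁ W} {f′ : Attachment t₁′ W}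
         (e : graft t₁ t₂ f ≈ᵀ graft t₁′ t₂′ f′) where

  private
    transfer : ∀ {t₁ t₁′ : Tree (V ⊕ •)} {t₂ t₂′ : Tree W} {f : Attachment t₁ W} {f′ : Attachment t₁′ W} →
               graft t₁ t₂ f ≈ᵀ graft t₁′ t₂′ f′ → ∀ u (p : T (adj t₁ (inj₁ u) (inj₂ tt))) →
               Σ[ p′ ∈ T (adj t₁′ (inj₁ u) (inj₂ tt)) ] f′ u p′ ≡ f u p
    transfer {t₁} {t₁′} {t₂} {t₂′} {f} {f′} e u p = Graft.cross⁻ t₁′ t₂′ f′
      (subst T (e (inj₁ u) (inj₂ (f u p))) (Graft.cross⁺ t₁ t₂ f p refl))

    e⁻¹ : graft t₁′ t₂′ f′ ≈ᵀ graft t₁ t₂ f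
    e⁻¹ u v = sym (e u v)

  graft-injective₁ : t₁ ≈ᵀ t₁′
  graft-injective₁ = tree-ext t₁ t₁′
    (λ u v → e (inj₁ u) (inj₁ v))
    (λ { u tt → T-ext (λ p → proj₁ (transfer {t₁} {t₁′} {t₂} {t₂′} {f} {f′} e u p))
                      (λ p → proj₁ (transfer {t₁′} {t₁} {t₂′} {t₂} {f′} {f} e⁻¹ u p)) })
    (λ { tt tt → trans (adj-irrefl t₁ (inj₂ tt)) (sym (adj-irrefl t₁′ (inj₂ tt))) })

  graft-injective₂ : t₂ ≈ᵀ t₂′
  graft-injective₂ w z = e (inj₂ w) (inj₂ z)

  graft-injective₃ : ∀ u .(p : T (adj t₁ (inj₁ u) (inj₂ tt))) .(p′ : T (adj t₁′ (inj₁ u) (inj₂ tt))) → f u p ≡ f′ u p′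
  graft-injective₃ u p p′ = sym (proj₂ (transfer {t₁} {t₁′} {t₂} {t₂′} {f} {f′} e u (T-irrelevant p)))

∘ᵀ-unique : (t₁ : Tree (V ⊕ •)) (t₂ : Tree W) → AllPairs (λ s t → ¬ (s ≈ᵀ t)) (t₁ ∘ᵀ t₂)
∘ᵀ-unique {V} {W} t₁ t₂ = AllPairsP.map⁺ (AllPairs.map
  (λ {f} {g} f≁g e → f≁g (λ u .p → graft-injective₃ {t₁ = t₁} {t₁} {t₂} {t₂} {f} {g} e u p p))
  (assignments-unique V (λ u → T? (adj t₁ (inj₁ u) (inj₂ tt))) W))

Consistent : (t : Tree (V ⊕ •)) (r : ∣ V ⊕ • ∣) → ∣ W ∣ → Attachment t W → Set
Consistent t r r₂ f = ∀ u (q : Parent t r u) → f u (parent-adjacent t r q) ≡ r₂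

module _ {V W} (t₁ : Tree (V ⊕ •)) (r₁ : ∣ V ⊕ • ∣) (r₂ : ∣ W ∣) where

  withParent-consistent : ∀ f → Consistent {W = W} t₁ r₁ r₂ (withParent {W = W} t₁ r₁ r₂ f)
  withParent-consistent f u q with parent? t₁ r₁ u
  ... | yes _ = refl
  ... | no ¬q = ⊥-elim (¬q q)

  withParent-restrict : ∀ {f : Attachment t₁ W} → Consistent {W = W} t₁ r₁ r₂ f →
                        f ≐ withParent {W = W} t₁ r₁ r₂ (λ u c → f u (proj₁ c))
  withParent-restrict c u p with parent? t₁ r₁ u
  ... | yes q = c u q
  ... | no ¬q = refl

  withParent-cong : ∀ {f g} → f ≐ g → withParent {W = W} t₁ r₁ r₂ f ≐ withParent {W = W} t₁ r₁ r₂ g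
  withParent-cong e u p with parent? t₁ r₁ u
  ... | yes _ = refl
  ... | no ¬q = e u (p , ¬q)

  withParent-injective : ∀ {f g} → withParent {W = W} t₁ r₁ r₂ f ≐ withParent {W = W} t₁ r₁ r₂ g → f ≐ g
  withParent-injective e u c with parent? t₁ r₁ u | e u (proj₁ c)
  ... | yes q | _  = ⊥-elim-irr (proj₂ c q)
  ... | no ¬q | e′ = e′

∈ᴿ⁺ : (t₁ : RootedTree (V ⊕ •)) (t₂ : RootedTree W) {t : RootedTree (V ⊕ W)} (f : Attachment (tree t₁) W) →
      Consistent {W = W} (tree t₁) (root t₁) (root t₂) f → t ≈ᴿ rooted (graft (tree t₁) (tree t₂) f) (graftRoot (root t₁) (root t₂)) →
      Any (t ≈ᴿ_) (t₁ ∘ᴿ t₂)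
∈ᴿ⁺ {V} {W} (rooted t₁ r₁) (rooted t₂ r₂) {rooted t r} f c (e , e′) = AnyP.map⁺ (Any.map
  (λ {g} f≐g → ≈ᵀ-trans {s = t} {graft t₁ t₂ f} {graft t₁ t₂ (withParent {W = W} t₁ r₁ r₂ g)} e
                 (graft-cong t₁ t₂ λ u .p → trans (withParent-restrict {W = W} t₁ r₁ r₂ c u p) (withParent-cong {W = W} t₁ r₁ r₂ f≐g u p))
             , e′)
  (assignments-complete V (child? t₁ r₁) W (λ u c → f u (proj₁ c))))

∈ᴿ⁻ : (t₁ : RootedTree (V ⊕ •)) (t₂ : RootedTree W) {t : RootedTree (V ⊕ W)} → Any (t ≈ᴿ_) (t₁ ∘ᴿ t₂) →
      Σ[ f ∈ Attachment (tree t₁) W ] Consistent {W = W} (tree t₁) (root t₁) (root t₂) f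
        × t ≈ᴿ rooted (graft (tree t₁) (tree t₂) f) (graftRoot (root t₁) (root t₂))
∈ᴿ⁻ {V} {W} (rooted t₁ r₁) (rooted t₂ r₂) i with Any.satisfied (AnyP.map⁻ i)
... | f , e = withParent {W = W} t₁ r₁ r₂ f , withParent-consistent {W = W} t₁ r₁ r₂ f , e

∘ᴿ-unique : (t₁ : RootedTree (V ⊕ •)) (t₂ : RootedTree W) → AllPairs (λ s t → ¬ (s ≈ᴿ t)) (t₁ ∘ᴿ t₂)
∘ᴿ-unique {V} {W} (rooted t₁ r₁) (rooted t₂ r₂) = AllPairsP.map⁺ (AllPairs.map
  (λ {f} {g} f≁g e → f≁g (withParent-injective {W = W} t₁ r₁ r₂
    (λ u .p → graft-injective₃ {t₁ = t₁} {t₁} {t₂} {t₂}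
      {withParent {W = W} t₁ r₁ r₂ f} {withParent {W = W} t₁ r₁ r₂ g} (proj₁ e) u p p)))
  (assignments-unique V (child? t₁ r₁) W))

-- The laws that make the linearisation of _∙_, which sends two basis elements
-- to the sum of a list of basis elements, an operad composition.
record BasisOperad : Set₁ where
  infixl 7 _∙_
  infix  4 _≈_ _∈_
  field
    basis : FinSet → Setoid 0ℓ 0ℓ

  X : FinSet → Set
  X V = Setoid.Carrier (basis V)

  _≈_ : Rel (X V) 0ℓ
  _≈_ {V} = Setoid._≈_ (basis V)

  _∈_ : X V → List (X V) → Set
  x ∈ xs = Any (x ≈_) xs

  field
    rename       : V ≅ W → X V → X W
    rename-cong  : (σ : V ≅ W) {x y : X V} → x ≈ y → rename σ x ≈ rename σ y
    rename-ext   : {σ τ : V ≅ W} → (∀ v → to σ v ≡ to τ v) → (x : X V) → rename σ x ≈ rename τ x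
    rename-id    : (x : X V) → rename idᵇ x ≈ x
    rename-∘     : (σ : V ≅ W) (τ : U ≅ V) (x : X U) → rename (σ ∘ᵇ τ) x ≈ rename σ (rename τ x)
    inhabited    : X V → ∣ V ∣
    unit         : ∀ V → Singleton V → X V
    unit-natural : (σ : V ≅ W) (v : Singleton V) (w : Singleton W) → rename σ (unit V v) ≈ unit W w
    _∙_          : X (V ⊕ •) → X W → List (X (V ⊕ W))

  field
    ∙-unique    : (x : X (V ⊕ •)) (y : X W) → AllPairs (λ s t → ¬ (s ≈ t)) (x ∙ y)
    ∙-injective : {x x′ : X (V ⊕ •)} {y y′ : X W} {t : X (V ⊕ W)} →
                  t ∈ x ∙ y → t ∈ x′ ∙ y′ → x ≈ x′ × y ≈ y′
    ∙-cong      : {x x′ : X (V ⊕ •)} {y y′ : X W} {t : X (V ⊕ W)} →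
                  x ≈ x′ → y ≈ y′ → t ∈ x ∙ y → t ∈ x′ ∙ y′
    ∙-natural   : (σ : V ≅ V′) (τ : W ≅ W′) {x : X (V ⊕ •)} {y : X W} {t : X (V ⊕ W)} →
                  t ∈ x ∙ y → rename (σ ⊕ᵇ τ) t ∈ rename (σ ⊕ᵇ idᵇ) x ∙ rename τ y
    ∙-unitˡ⁺    : (s : Singleton (∅ ⊕ •)) (y : X V) → rename (identityˡᵇ ⁻¹) y ∈ unit (∅ ⊕ •) s ∙ y
    ∙-unitˡ⁻    : (s : Singleton (∅ ⊕ •)) (y : X V) {t : X (∅ ⊕ V)} →
                  t ∈ unit (∅ ⊕ •) s ∙ y → t ≈ rename (identityˡᵇ ⁻¹) y
    ∙-unitʳ⁺    : (w : Singleton W) (x : X (V ⊕ •)) → rename (idᵇ ⊕ᵇ singletonᵇ w) x ∈ x ∙ unit W w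
    ∙-unitʳ⁻    : (w : Singleton W) (x : X (V ⊕ •)) {t : X (V ⊕ W)} →
                  t ∈ x ∙ unit W w → t ≈ rename (idᵇ ⊕ᵇ singletonᵇ w) x
    ∙-assoc⁺    : (x : X (V ⊕ •)) (y : X (W ⊕ •)) (z : X Z) {s : X (V ⊕ (W ⊕ •))} {t : X ((V ⊕ W) ⊕ Z)} →
                  s ∈ x ∙ y → t ∈ rename (assocᵇ ⁻¹) s ∙ z →
                  ∃[ r ] r ∈ y ∙ z × rename assocᵇ t ∈ x ∙ r
    ∙-assoc⁻    : (x : X (V ⊕ •)) (y : X (W ⊕ •)) (z : X Z) {r : X (W ⊕ Z)} {t : X (V ⊕ (W ⊕ Z))} →
                  r ∈ y ∙ z → t ∈ x ∙ r →
                  ∃[ s ] s ∈ x ∙ y × rename (assocᵇ ⁻¹) t ∈ rename (assocᵇ ⁻¹) s ∙ z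
    ∙-exchange  : (x : X ((V ⊕ •) ⊕ •)) (y : X W) (z : X Z) {s : X ((V ⊕ •) ⊕ W)} {t : X ((V ⊕ W) ⊕ Z)} →
                  s ∈ x ∙ y → t ∈ rename exchangeᵇ s ∙ z →
                  ∃[ r ] r ∈ rename exchangeᵇ x ∙ z × rename exchangeᵇ t ∈ rename exchangeᵇ r ∙ y

relabel-ext : {σ τ : V ≅ W} → (∀ v → to σ v ≡ to τ v) → (t : Tree V) → relabel σ t ≈ᵀ relabel τ t
relabel-ext {σ = σ} {τ} e t u v = cong₂ (adj t) (from-ext u) (from-ext v)
  where
  from-ext : ∀ w → from σ w ≡ from τ w
  from-ext w = trans (cong (from σ) (trans (sym (strictlyInverseˡ τ w)) (sym (e (from τ w))))) (strictlyInverseʳ σ (from τ w))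

-- How an attachment is carried along each law; the rooted versions reuse them.
module CongT {V W} {x x′ : Tree (V ⊕ •)} {y y′ : Tree W} (ex : x ≈ᵀ x′) (ey : y ≈ᵀ y′) (f : Attachment x W) where

  f′ : Attachment x′ W
  f′ u p = f u (subst T (sym (ex (inj₁ u) (inj₂ tt))) p)

  equal : graft x y f ≈ᵀ graft x′ y′ f′
  equal = tree-ext (graft x y f) (graft x′ y′ f′)
    (λ u v → ex (inj₁ u) (inj₁ v))
    (λ u w → move (ex (inj₁ u) (inj₂ tt)) (λ _ _ → refl))
    ey
    where
    move : ∀ {b b′} {g : .(T b) → ∣ W ∣} {g′ : .(T b′) → ∣ W ∣} {w} → b ≡ b′ →
           (.(p : T b) .(p′ : T b′) → g p ≡ g′ p′) → attached W b g w ≡ attached W b′ g′ w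
    move {b} {w = w} refl e = attached-cong W {b} (λ p → e p p) w

module NaturalT {V V′ W W′} (σ : V ≅ V′) (τ : W ≅ W′) (x : Tree (V ⊕ •)) (y : Tree W) (f : Attachment x W) where

  f′ : Attachment (relabel (σ ⊕ᵇ idᵇ {•}) x) W′
  f′ u p = to τ (f (from σ u) p)

  equal : relabel (σ ⊕ᵇ τ) (graft x y f) ≈ᵀ graft (relabel (σ ⊕ᵇ idᵇ {•}) x) (relabel τ y) f′
  equal = tree-ext (relabel (σ ⊕ᵇ τ) (graft x y f)) (graft (relabel (σ ⊕ᵇ idᵇ {•}) x) (relabel τ y) f′)
    (λ _ _ → refl)
    (λ u w → let b = adj x (inj₁ (from σ u)) (inj₂ tt) in T-ext
      (λ p → let q , e = attached⁻ W b (f (from σ u)) p in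
             attached⁺ W′ b (f′ u) q (trans (cong (to τ) e) (strictlyInverseˡ τ w)))
      (λ p → let q , e = attached⁻ W′ b (f′ u) p in
             attached⁺ W b (f (from σ u)) q (trans (sym (strictlyInverseʳ τ _)) (cong (from τ) e))))
    (λ _ _ → refl)

module UnitˡT {V} (s : Singleton (∅ ⊕ •)) (y : Tree V) (f : Attachment (vertex (∅ ⊕ •) s) V) where

  equal : relabel (identityˡᵇ ⁻¹) y ≈ᵀ graft (vertex (∅ ⊕ •) s) y f
  equal = tree-ext (relabel (identityˡᵇ ⁻¹) y) (graft (vertex (∅ ⊕ •) s) y f) (λ ()) (λ ()) (λ _ _ → refl)

module UnitʳT {V W} (w : Singleton W) (x : Tree (V ⊕ •)) (f : Attachment x W) where

  equal : relabel (idᵇ {V} ⊕ᵇ singletonᵇ w) x ≈ᵀ graft x (vertex W w) f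
  equal = tree-ext (relabel (idᵇ {V} ⊕ᵇ singletonᵇ w) x) (graft x (vertex W w) f)
    (λ _ _ → refl)
    (λ u v → let b = adj x (inj₁ u) (inj₂ tt) in T-ext
      (λ p → attached⁺ W b (f u) p (trans (proj₂ w (f u p)) (sym (proj₂ w v))))
      (λ p → proj₁ (attached⁻ W b (f u) p)))
    (λ _ _ → adj-irrefl x (inj₂ tt))

module AssocT {V W Z} (x : Tree (V ⊕ •)) (y : Tree (W ⊕ •)) (z : Tree Z) where

  module _ (f : Attachment x (W ⊕ •)) (g : Attachment (relabel (assocᵇ ⁻¹) (graft x y f)) Z) where

    g′ : Attachment y Z
    g′ w p = g (inj₂ w) p

    target : ∀ u .(p : T (adj x (inj₁ u) (inj₂ tt))) (v : ∣ W ⊕ • ∣) → .(f u p ≡ v) → ∣ W ⊕ Z ∣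
    target u p (inj₁ w)  e = inj₁ w
    target u p (inj₂ tt) e = inj₂ (g (inj₁ u) (attached⁺ (W ⊕ •) _ (f u) p e))

    f′ : Attachment x (W ⊕ Z)
    f′ u p = target u p (f u p) refl

    target-≡ : ∀ u .(p : T (adj x (inj₁ u) (inj₂ tt))) {v} (e : f u p ≡ v) → f′ u p ≡ target u p v e
    target-≡ u p refl = refl

    equal : relabel assocᵇ (graft (relabel (assocᵇ ⁻¹) (graft x y f)) z g) ≈ᵀ graft x (graft y z g′) f′
    equal = tree-ext (relabel assocᵇ (graft (relabel (assocᵇ ⁻¹) (graft x y f)) z g)) (graft x (graft y z g′) f′)
      (λ _ _ → refl)
      (λ { u (inj₁ w) → let b = adj x (inj₁ u) (inj₂ tt) in T-ext
             (λ p → let q , e = attached⁻ (W ⊕ •) b (f u) p in attached⁺ (W ⊕ Z) b (f′ u) q (target-≡ u q e))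
             (λ p → let q , e = attached⁻ (W ⊕ Z) b (f′ u) p in attached⁺ (W ⊕ •) b (f u) q (back₁ u q (f u q) refl e))
         ; u (inj₂ v) → let b = adj x (inj₁ u) (inj₂ tt); b′ = attached (W ⊕ •) b (f u) (inj₂ tt) in T-ext
             (λ p → let q , e = attached⁻ Z b′ (g (inj₁ u)) p
                        q′ , e′ = attached⁻ (W ⊕ •) b (f u) q
                    in attached⁺ (W ⊕ Z) b (f′ u) q′ (trans (target-≡ u q′ e′) (cong inj₂ e)))
             (λ p → let q , e = attached⁻ (W ⊕ Z) b (f′ u) p
                        q′ , e′ = back₂ u q (f u q) refl e
                    in attached⁺ Z b′ (g (inj₁ u)) (attached⁺ (W ⊕ •) b (f u) q q′) e′)
         })
      (λ { (inj₁ _) (inj₁ _) → refl ; (inj₁ _) (inj₂ _) → refl ; (inj₂ _) (inj₁ _) → refl ; (inj₂ _) (inj₂ _) → refl })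
      where
      back₁ : ∀ u (p : T (adj x (inj₁ u) (inj₂ tt))) v (e : f u p ≡ v) {w} → target u p v e ≡ inj₁ w → f u p ≡ inj₁ w
      back₁ u p (inj₁ w)  e refl = e
      back₂ : ∀ u (p : T (adj x (inj₁ u) (inj₂ tt))) v (e : f u p ≡ v) {w} → target u p v e ≡ inj₂ w →
              Σ[ e′ ∈ f u p ≡ inj₂ tt ] g (inj₁ u) (attached⁺ (W ⊕ •) _ (f u) p e′) ≡ w
      back₂ u p (inj₂ tt) e refl = e , refl

  module _ (k : Attachment y Z) (h : Attachment x (W ⊕ Z)) where

    contract : ∣ W ⊕ Z ∣ → ∣ W ⊕ • ∣
    contract (inj₁ w) = inj₁ w
    contract (inj₂ _) = inj₂ tt

    f⁻ : Attachment x (W ⊕ •)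
    f⁻ u p = contract (h u p)

    fromZ : (v : ∣ W ⊕ Z ∣) → .(contract v ≡ inj₂ tt) → ∣ Z ∣
    fromZ (inj₁ _) e = ⊥-elim-irr (case e)
      where case : ∀ {w} → inj₁ w ≡ inj₂ tt → ⊥
            case ()
    fromZ (inj₂ v) e = v

    g⁻ : Attachment (relabel (assocᵇ ⁻¹) (graft x y f⁻)) Z
    g⁻ (inj₁ u) p = fromZ (h u (proj₁ (attached⁻ (W ⊕ •) _ (f⁻ u) p))) (proj₂ (attached⁻ (W ⊕ •) _ (f⁻ u) p))
    g⁻ (inj₂ w) p = k w p

    f⁻-inverse : f′ f⁻ g⁻ ≐ h
    f⁻-inverse u p = go (f⁻ u p) refl
      where
      go : ∀ v (e : f⁻ u p ≡ v) → target f⁻ g⁻ u p v e ≡ h u p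
      go (inj₁ w) e with h u p | e
      ... | inj₁ _ | refl = refl
      go (inj₂ tt) e with h u p | e
      ... | inj₂ _ | refl = refl

    equal⁻ : relabel (assocᵇ ⁻¹) (graft x (graft y z k) h) ≈ᵀ graft (relabel (assocᵇ ⁻¹) (graft x y f⁻)) z g⁻
    equal⁻ u v = trans
      (sym (trans (equal f⁻ g⁻ (Sum.assocʳ u) (Sum.assocʳ v))
                  (graft-cong x (graft y z k) f⁻-inverse (Sum.assocʳ u) (Sum.assocʳ v))))
      (cong₂ (adj (graft (relabel (assocᵇ ⁻¹) (graft x y f⁻)) z g⁻))
        (strictlyInverseʳ (assocᵇ {V} {W} {Z}) u) (strictlyInverseʳ (assocᵇ {V} {W} {Z}) v))

module ExchangeT {V W Z} (x : Tree ((V ⊕ •) ⊕ •)) (y : Tree W) (z : Tree Z)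
                 (f : Attachment x W) (g : Attachment (relabel (exchangeᵇ {V} {•} {W}) (graft x y f)) Z) where

  x′ : Tree ((V ⊕ •) ⊕ •)
  x′ = relabel (exchangeᵇ {V} {•} {•}) x

  f′ : Attachment x′ Z
  f′ (inj₁ v)  p = g (inj₁ v) p
  f′ (inj₂ tt) p = g (inj₂ (f (inj₂ tt) (Tree.symmetric x p))) (attached⁺ W _ (f (inj₂ tt)) (Tree.symmetric x p) refl)

  g′ : Attachment (relabel (exchangeᵇ {V} {•} {Z}) (graft x′ z f′)) W
  g′ (inj₁ v) p = f (inj₁ v) p
  g′ (inj₂ _) p = f (inj₂ tt) (Tree.symmetric x (proj₁ (attached⁻ Z _ (f′ (inj₂ tt)) p)))

  equal : relabel (exchangeᵇ {V} {W} {Z}) (graft (relabel (exchangeᵇ {V} {•} {W}) (graft x y f)) z g)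
          ≈ᵀ graft (relabel (exchangeᵇ {V} {•} {Z}) (graft x′ z f′)) y g′
  equal = tree-ext (relabel (exchangeᵇ {V} {W} {Z}) (graft (relabel (exchangeᵇ {V} {•} {W}) (graft x y f)) z g))
                   (graft (relabel (exchangeᵇ {V} {•} {Z}) (graft x′ z f′)) y g′)
    (λ { (inj₁ _) (inj₁ _) → refl ; (inj₁ _) (inj₂ _) → refl ; (inj₂ _) (inj₁ _) → refl ; (inj₂ _) (inj₂ _) → refl })
    (λ { (inj₁ _) w → refl
       ; (inj₂ v) w →
         let b  = adj x (inj₁ (inj₂ tt)) (inj₂ tt); b′ = adj x (inj₂ tt) (inj₁ (inj₂ tt))
             B  = attached W b (f (inj₂ tt)) w;     B′ = attached Z b′ (f′ (inj₂ tt)) v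
         in T-ext
         (λ p → let q , e = attached⁻ Z B (g (inj₂ w)) p
                    q₁ , e₁ = attached⁻ W b (f (inj₂ tt)) q
                in attached⁺ W B′ (g′ (inj₂ v)) (attached⁺ Z b′ (f′ (inj₂ tt)) (Tree.symmetric x q₁) (trans (move e₁ _ _) e)) e₁)
         (λ p → let q , e = attached⁻ W B′ (g′ (inj₂ v)) p
                    q₁ , e₁ = attached⁻ Z b′ (f′ (inj₂ tt)) q
                in attached⁺ Z B (g (inj₂ w)) (attached⁺ W b (f (inj₂ tt)) (Tree.symmetric x q₁) e) (trans (sym (move e _ _)) e₁))
       })
    (λ _ _ → refl)
    where
    move : ∀ {w w′} → w ≡ w′ → .(p : _) .(p′ : _) → g (inj₂ w) p ≡ g (inj₂ w′) p′
    move refl p p′ = refl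

treeBasisOperad : BasisOperad
treeBasisOperad = record
  { basis        = treeSetoid
  ; rename       = relabel
  ; rename-cong  = λ σ e u v → e (from σ u) (from σ v)
  ; rename-ext   = λ {_} {_} {σ} {τ} e t → relabel-ext {σ = σ} {τ} e t
  ; rename-id    = λ _ _ _ → refl
  ; rename-∘     = λ _ _ _ _ _ → refl
  ; inhabited    = nonempty
  ; unit         = vertex
  ; unit-natural = λ _ _ _ _ _ → refl
  ; _∙_          = _∘ᵀ_
  ; ∙-unique     = ∘ᵀ-unique
  ; ∙-injective  = λ {_} {_} {x} {x′} {y} {y′} {t} i i′ →
      let f  , e  = ∈ᵀ⁻ x y {t} i
          f′ , e′ = ∈ᵀ⁻ x′ y′ {t} i′
          e″ = λ u v → trans (sym (e u v)) (e′ u v)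
      in graft-injective₁ {t₁ = x} {x′} {y} {y′} {f} {f′} e″ , graft-injective₂ {t₁ = x} {x′} {y} {y′} {f} {f′} e″
  ; ∙-cong       = λ {_} {_} {x} {x′} {y} {y′} {t} ex ey i →
      let f , e = ∈ᵀ⁻ x y {t} i
          module C = CongT {x = x} {x′} {y} {y′} ex ey f
      in ∈ᵀ⁺ x′ y′ {t} C.f′ (λ u v → trans (e u v) (C.equal u v))
  ; ∙-natural    = λ {_} {_} {_} {_} σ τ {x} {y} {t} i →
      let f , e = ∈ᵀ⁻ x y {t} i
          module N = NaturalT σ τ x y f
      in ∈ᵀ⁺ (relabel (σ ⊕ᵇ idᵇ) x) (relabel τ y) {relabel (σ ⊕ᵇ τ) t} N.f′ (λ u v → trans (e _ _) (N.equal u v))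
  ; ∙-unitˡ⁺     = λ s y → ∈ᵀ⁺ (vertex (∅ ⊕ •) s) y {relabel (identityˡᵇ ⁻¹) y} (λ ()) (UnitˡT.equal s y (λ ()))
  ; ∙-unitˡ⁻     = λ s y {t} i → let f , e = ∈ᵀ⁻ (vertex (∅ ⊕ •) s) y {t} i in
      λ u v → trans (e u v) (sym (UnitˡT.equal s y f u v))
  ; ∙-unitʳ⁺     = λ {W} {V} w x →
      ∈ᵀ⁺ x (vertex W w) {relabel (idᵇ ⊕ᵇ singletonᵇ w) x} (λ _ _ → proj₁ w) (UnitʳT.equal w x (λ _ _ → proj₁ w))
  ; ∙-unitʳ⁻     = λ {W} {V} w x {t} i → let f , e = ∈ᵀ⁻ x (vertex W w) {t} i in
      λ u v → trans (e u v) (sym (UnitʳT.equal {V} {W} w x f u v))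
  ; ∙-assoc⁺     = λ x y z {s} {t} i j →
      let f  , e  = ∈ᵀ⁻ x y {s} i
          g₀ , e₀ = ∈ᵀ⁻ (relabel (assocᵇ ⁻¹) s) z {t} j
          module C = CongT {x = relabel (assocᵇ ⁻¹) s} {relabel (assocᵇ ⁻¹) (graft x y f)} {z} {z}
                           (λ u v → e _ _) (λ _ _ → refl) g₀
          g  = C.f′
          module A = AssocT x y z
      in graft y z (A.g′ f g)
         , ∈ᵀ⁺ y z {graft y z (A.g′ f g)} (A.g′ f g) (λ _ _ → refl)
         , ∈ᵀ⁺ x (graft y z (A.g′ f g)) {relabel assocᵇ t} (A.f′ f g)
             (λ u v → trans (trans (e₀ (Sum.assocˡ u) (Sum.assocˡ v)) (C.equal (Sum.assocˡ u) (Sum.assocˡ v))) (A.equal f g u v))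
  ; ∙-assoc⁻     = λ x y z {r} {t} i j →
      let g′ , e  = ∈ᵀ⁻ y z {r} i
          f₀ , e₀ = ∈ᵀ⁻ x r {t} j
          module C = CongT {x = x} {x} {r} {graft y z g′} (λ _ _ → refl) e f₀
          module A = AssocT x y z
          s  = graft x y (A.f⁻ g′ C.f′)
      in s
         , ∈ᵀ⁺ x y {s} (A.f⁻ g′ C.f′) (λ _ _ → refl)
         , ∈ᵀ⁺ (relabel (assocᵇ ⁻¹) s) z {relabel (assocᵇ ⁻¹) t} (A.g⁻ g′ C.f′)
             (λ u v → trans (trans (e₀ (Sum.assocʳ u) (Sum.assocʳ v)) (C.equal (Sum.assocʳ u) (Sum.assocʳ v))) (A.equal⁻ g′ C.f′ u v))
  ; ∙-exchange   = λ x y z {s} {t} i j →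
      let f  , e  = ∈ᵀ⁻ x y {s} i
          g₀ , e₀ = ∈ᵀ⁻ (relabel exchangeᵇ s) z {t} j
          module C = CongT {x = relabel exchangeᵇ s} {relabel exchangeᵇ (graft x y f)} {z} {z}
                           (λ u v → e _ _) (λ _ _ → refl) g₀
          g  = C.f′
          module E = ExchangeT x y z f g
          r  = graft E.x′ z E.f′
      in r
         , ∈ᵀ⁺ E.x′ z {r} E.f′ (λ _ _ → refl)
         , ∈ᵀ⁺ (relabel exchangeᵇ r) y {relabel exchangeᵇ t} E.g′
             (λ u v → trans (trans (e₀ (exchange u) (exchange v)) (C.equal (exchange u) (exchange v))) (E.equal u v))
  }

parent-cong : {t t′ : Tree (V ⊕ •)} → t ≈ᵀ t′ → ∀ r {u} → Parent t r u → Parent t′ r u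
parent-cong e (inj₁ r) (p , w) =
  subst T (e (inj₁ _) (inj₂ tt)) p , Star.map (λ {a} {b} → subst T (e (inj₁ a) (inj₁ b))) w

consistent-cong : {x x′ : Tree (V ⊕ •)} {y y′ : Tree W} (ex : x ≈ᵀ x′) (ey : y ≈ᵀ y′) {f : Attachment x W} →
                  ∀ r r₂ → Consistent {W = W} x r r₂ f →
                  Consistent {W = W} x′ r r₂ (CongT.f′ {x = x} {x′} {y} {y′} ex ey f)
consistent-cong {x = x} {x′} ex ey r r₂ c u q = c u (parent-cong {t = x′} {x} (λ a b → sym (ex a b)) r q)

consistent-natural : (σ : V ≅ V′) (τ : W ≅ W′) (x : Tree (V ⊕ •)) (y : Tree W) (f : Attachment x W) → ∀ r r₂ →
                     Consistent {W = W} x r r₂ f →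
                     Consistent {W = W′} (relabel (σ ⊕ᵇ idᵇ {•}) x) (to (σ ⊕ᵇ idᵇ {•}) r) (to τ r₂) (NaturalT.f′ σ τ x y f)
consistent-natural σ τ x y f (inj₁ r) r₂ c u (p , w) = cong (to τ) (c (from σ u)
  (p , subst (Star _ _) (strictlyInverseʳ σ r) (Star.gmap (from σ) id w)))

graftRoot-natural : ∀ (σ : V ≅ V′) (τ : W ≅ W′) r₁ r₂ →
                    to (σ ⊕ᵇ τ) (graftRoot r₁ r₂) ≡ graftRoot (to (σ ⊕ᵇ idᵇ {•}) r₁) (to τ r₂)
graftRoot-natural σ τ (inj₁ _) r₂ = refl
graftRoot-natural σ τ (inj₂ _) r₂ = refl

graftRoot-injective : {t : Tree (V ⊕ •)} {t′ : Tree (V ⊕ •)} {s s′ : Tree W} {f : Attachment t W} {f′ : Attachment t′ W} →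
  graft t s f ≈ᵀ graft t′ s′ f′ → ∀ r r′ {q q′} →
  Consistent {W = W} t r q f → Consistent {W = W} t′ r′ q′ f′ → graftRoot r q ≡ graftRoot r′ q′ → r ≡ r′ × q ≡ q′
graftRoot-injective {t = t} {t′} {s} {s′} {f} {f′} e (inj₁ r) (inj₁ _) c c′ refl with parent-exists t r
... | u , p = refl , trans (sym (c u p)) (trans
  (graft-injective₃ {t₁ = t} {t′} {s} {s′} {f} {f′} e u (proj₁ p) (proj₁ p′))
  (c′ u p′))
  where p′ = parent-cong {t = t} {t′} (graft-injective₁ {t₁ = t} {t′} {s} {s′} {f} {f′} e) (inj₁ r) p
graftRoot-injective e (inj₂ _) (inj₂ _) c c′ refl = refl , refl

module AssocR {V W Z} (x : Tree (V ⊕ •)) (y : Tree (W ⊕ •)) (z : Tree Z)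
              (rx : ∣ V ⊕ • ∣) (ry : ∣ W ⊕ • ∣) (rz : ∣ Z ∣)
              (f : Attachment x (W ⊕ •)) (g : Attachment (relabel (assocᵇ ⁻¹) (graft x y f)) Z)
              (cf : Consistent {W = W ⊕ •} x rx ry f) where

  open AssocT x y z

  s : Tree ((V ⊕ W) ⊕ •)
  s = relabel (assocᵇ ⁻¹) (graft x y f)

  rs : ∣ (V ⊕ W) ⊕ • ∣
  rs = Sum.assocˡ (graftRoot rx ry)

  parent₁ : ry ≡ inj₂ tt → ∀ {u} → Parent x rx u → Parent s rs (inj₁ u)
  parent₁ refl {u} q = go rx q (cf u q)
    where
    go : ∀ rx {u} (q : Parent x rx u) → f u (parent-adjacent x rx q) ≡ inj₂ tt →
         Parent s (Sum.assocˡ (graftRoot rx (inj₂ tt))) (inj₁ u)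
    go (inj₁ r) (e , w) eq = Graft.cross⁺ x y f e eq , Star.gmap inj₁ id w

  parent₂ : ∀ {w} → Parent y ry w → Parent s rs (inj₂ w)
  parent₂ = go rx ry cf
    where
    go : ∀ rx ry → Consistent {W = W ⊕ •} x rx ry f → ∀ {w} → Parent y ry w →
         Parent s (Sum.assocˡ (graftRoot rx ry)) (inj₂ w)
    go (inj₂ _) (inj₁ q) c (e , p) = e , Star.gmap inj₂ id p
    go (inj₁ r) (inj₁ q) c (e , p) with parent-exists x r
    ... | u , e′ , p′ = e , Star.gmap inj₂ id p ◅◅ Graft.cross⁺ x y f e′ (c u (e′ , p′)) ◅ Star.gmap inj₁ id p′

  root-≡ : Sum.assocʳ (graftRoot rs rz) ≡ graftRoot rx (graftRoot ry rz)
  root-≡ = go rx ry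
    where
    go : ∀ rx ry → Sum.assocʳ (graftRoot (Sum.assocˡ (graftRoot rx ry)) rz) ≡ graftRoot rx (graftRoot ry rz)
    go (inj₁ _) _        = refl
    go (inj₂ _) (inj₁ _) = refl
    go (inj₂ _) (inj₂ _) = refl

  module _ (cg : Consistent {W = Z} s rs rz g) where

    consistent-g′ : Consistent {W = Z} y ry rz (g′ f g)
    consistent-g′ w q = cg (inj₂ w) (parent₂ q)

    consistent-f′ : Consistent {W = W ⊕ Z} x rx (graftRoot ry rz) (f′ f g)
    consistent-f′ u q = trans (target-≡ f g u (parent-adjacent x rx q) (cf u q)) (go ry (cf u q) refl)
      where
      go : ∀ v (e : f u (parent-adjacent x rx q) ≡ v) → ry ≡ v →
           target f g u (parent-adjacent x rx q) v e ≡ graftRoot v rz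
      go (inj₁ w)  e e′ = refl
      go (inj₂ tt) e e′ = cong inj₂ (cg (inj₁ u) (parent₁ e′ q))

  consistent-g : (∀ {w} → Parent y ry w → .(p : T (adj s (inj₁ (inj₂ w)) (inj₂ tt))) → g (inj₂ w) p ≡ rz) →
                 (ry ≡ inj₂ tt → ∀ {u} → Parent x rx u → .(p : T (adj s (inj₁ (inj₁ u)) (inj₂ tt))) → g (inj₁ u) p ≡ rz) →
                 Consistent {W = Z} s rs rz g
  consistent-g onW onV v q = go rx ry refl refl
    where
    move : ∀ {v′} → v ≡ v′ → (.(p : T (adj s (inj₁ v′) (inj₂ tt))) → g v′ p ≡ rz) →
           g v (parent-adjacent s rs q) ≡ rz
    move refl e = e (parent-adjacent s rs q)
    absurd : ∀ r {v} → r ≡ inj₂ tt → ¬ Parent s r v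
    absurd _ refl ()
    go : ∀ rx′ ry′ → rx ≡ rx′ → ry ≡ ry′ → g v (parent-adjacent s rs q) ≡ rz
    go rx′ (inj₁ b) e refl = let w , p = parent-exists y b in move (parent-unique s rs q (parent₂ p)) (onW p)
    go (inj₁ a) (inj₂ _) refl refl = let u , p = parent-exists x a in move (parent-unique s rs q (parent₁ refl p)) (onV refl p)
    go (inj₂ _) (inj₂ _) refl refl = ⊥-elim (absurd rs {v} refl q)

module ExchangeR {V W} (x : Tree ((V ⊕ •) ⊕ •)) (y : Tree W) (f : Attachment x W)
                 (rx : ∣ (V ⊕ •) ⊕ • ∣) (ry : ∣ W ∣) where

  x′ : Tree ((V ⊕ •) ⊕ •)
  x′ = relabel (exchangeᵇ {V} {•} {•}) x

  s : Tree ((V ⊕ W) ⊕ •)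
  s = relabel (exchangeᵇ {V} {•} {W}) (graft x y f)

  -- v′ is a vertex of s that replaces the vertex v of x′.
  data Over : ∣ V ⊕ • ∣ → ∣ V ⊕ W ∣ → Set where
    old : ∀ {v} → Over (inj₁ v) (inj₁ v)
    new : ∀ {w} → Over (inj₂ tt) (inj₂ w)

  walk : ∀ {v v₂ v′ v₂′} → Star (λ a b → T (adj x′ (inj₁ a) (inj₁ b))) v v₂ → Over v v′ → Over v₂ v₂′ →
         Star (λ a b → T (adj s (inj₁ a) (inj₁ b))) v′ v₂′
  walk ε old old = ε
  walk ε (new {w}) (new {w₂}) = Star.gmap inj₂ id (Tree.connected y w w₂)
  walk (_◅_ {i = inj₁ _} {j = inj₁ _} e es) old o = e ◅ walk es old o
  walk (_◅_ {i = inj₁ v} {j = inj₂ _} e es) old o = Graft.cross⁺ x y f e refl ◅ walk es (new {f (inj₁ v) e}) o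
  walk (_◅_ {i = inj₂ _} {j = inj₁ v} e es) (new {w}) o =
    Star.gmap inj₂ id (Tree.connected y w (f (inj₁ v) (Tree.symmetric x e)))
      ◅◅ Graft.cross⁺ x y f (Tree.symmetric x e) refl ◅ walk es old o
  walk (_◅_ {i = inj₂ _} {j = inj₂ _} e es) new o = ⊥-elim (Tree.irreflexive x e)

  over : ∀ q → .(T (adj x′ (inj₁ q) (inj₂ tt))) → ∣ V ⊕ W ∣
  over (inj₁ v)  p = inj₁ v
  over (inj₂ tt) p = inj₂ (f (inj₂ tt) (Tree.symmetric x p))

  parent : ∀ {q} (p : Parent x′ (exchange rx) q) →
           Parent s (exchange (graftRoot rx ry)) (over q (parent-adjacent x′ (exchange rx) p))
  parent = go rx
    where
    go : ∀ rx {q} (p : Parent x′ (exchange rx) q) →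
         Parent s (exchange (graftRoot rx ry)) (over q (parent-adjacent x′ (exchange rx) p))
    go (inj₁ (inj₁ r)) {inj₁ v}  (e , p) = e , walk p old old
    go (inj₁ (inj₁ r)) {inj₂ tt} (e , p) = attached⁺ W _ (f (inj₂ tt)) (Tree.symmetric x e) refl , walk p new old
    go (inj₂ tt)       {inj₁ v}  (e , p) = e , walk p old new
    go (inj₂ tt)       {inj₂ tt} (e , p) = attached⁺ W _ (f (inj₂ tt)) (Tree.symmetric x e) refl , walk p new new

module ExchangeConsistent {V W Z} (x : Tree ((V ⊕ •) ⊕ •)) (y : Tree W) (z : Tree Z)
                          (rx : ∣ (V ⊕ •) ⊕ • ∣) (ry : ∣ W ∣) (rz : ∣ Z ∣)
                          (f : Attachment x W) (g : Attachment (relabel (exchangeᵇ {V} {•} {W}) (graft x y f)) Z)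
                          (cf : Consistent {W = W} x rx ry f)
                          (cg : Consistent {W = Z} (relabel (exchangeᵇ {V} {•} {W}) (graft x y f)) (exchange (graftRoot rx ry)) rz g) where

  open ExchangeT x y z f g
  private
    module E  = ExchangeR x y f rx ry
    module E′ = ExchangeR x′ z f′ (exchange rx) rz

  consistent-f′ : Consistent {W = Z} x′ (exchange rx) rz f′
  consistent-f′ (inj₁ v)  p = cg (inj₁ v) (E.parent {inj₁ v} p)
  consistent-f′ (inj₂ tt) p = cg _ (E.parent {inj₂ tt} p)

  root-≡ : exchange (graftRoot (exchange (graftRoot rx ry)) rz) ≡ graftRoot (exchange (graftRoot (exchange rx) rz)) ry
  root-≡ = go rx
    where
    go : ∀ rx → exchange (graftRoot (exchange (graftRoot rx ry)) rz) ≡ graftRoot (exchange (graftRoot (exchange rx) rz)) ry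
    go (inj₁ (inj₁ _)) = refl
    go (inj₁ (inj₂ _)) = refl
    go (inj₂ _)        = refl

  private
    s′ : Tree ((V ⊕ Z) ⊕ •)
    s′ = relabel (exchangeᵇ {V} {•} {Z}) (graft x′ z f′)

    rs′ : ∣ (V ⊕ Z) ⊕ • ∣
    rs′ = exchange (graftRoot (exchange rx) rz)

    x≈x″ : x ≈ᵀ relabel (exchangeᵇ {V} {•} {•}) x′
    x≈x″ u v = sym (cong₂ (adj x) (exchange-involutive u) (exchange-involutive v))

  consistent-g′ : Consistent {W = W} s′ rs′ ry g′
  consistent-g′ v q = go rx refl
    where
    move : ∀ {v′} → v ≡ v′ → (.(p : T (adj s′ (inj₁ v′) (inj₂ tt))) → g′ v′ p ≡ ry) →
           g′ v (parent-adjacent s′ rs′ q) ≡ ry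
    move refl e = e (parent-adjacent s′ rs′ q)
    absurd : ∀ r {v} → r ≡ inj₂ tt → ¬ Parent s′ r v
    absurd _ refl ()
    via : ∀ u → Parent x rx u → g′ v (parent-adjacent s′ rs′ q) ≡ ry
    via u p = step u p (E′.parent {u} (subst (λ r → Parent (relabel (exchangeᵇ {V} {•} {•}) x′) r u) (sym (exchange-involutive rx))
                (parent-cong {t = x} {relabel (exchangeᵇ {V} {•} {•}) x′} x≈x″ rx p)))
      where
      step : ∀ u (p : Parent x rx u) .{p′ : T (adj (relabel (exchangeᵇ {V} {•} {•}) x′) (inj₁ u) (inj₂ tt))} →
             Parent s′ rs′ (E′.over u p′) → g′ v (parent-adjacent s′ rs′ q) ≡ ry
      step (inj₁ u)  p q′ = move (parent-unique s′ rs′ q q′) (λ _ → cf (inj₁ u) p)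
      step (inj₂ tt) p q′ = move (parent-unique s′ rs′ q q′) (λ _ → cf (inj₂ tt) p)
    go : ∀ rx′ → rx ≡ rx′ → g′ v (parent-adjacent s′ rs′ q) ≡ ry
    go (inj₂ tt) refl = ⊥-elim (absurd rs′ {v} refl q)
    go (inj₁ a) refl = let u , p = parent-exists x a in via u p

rootedTreeBasisOperad : BasisOperad
rootedTreeBasisOperad = record
  { basis        = rootedTreeSetoid
  ; rename       = relabelᴿ
  ; rename-cong  = λ σ (e , e′) → (λ u v → e (from σ u) (from σ v)) , cong (to σ) e′
  ; rename-ext   = λ {_} {_} {σ} {τ} e (rooted t r) → relabel-ext {σ = σ} {τ} e t , e r
  ; rename-id    = λ _ → (λ _ _ → refl) , refl
  ; rename-∘     = λ _ _ _ → (λ _ _ → refl) , refl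
  ; inhabited    = root
  ; unit         = vertexᴿ
  ; unit-natural = λ σ v w → (λ _ _ → refl) , proj₂ w _
  ; _∙_          = _∘ᴿ_
  ; ∙-unique     = ∘ᴿ-unique
  ; ∙-injective  = λ {_} {_} {x} {x′} {y} {y′} {t} i i′ →
      let f  , c  , e  , er  = ∈ᴿ⁻ x y {t} i
          f′ , c′ , e′ , er′ = ∈ᴿ⁻ x′ y′ {t} i′
          e″ = λ u v → trans (sym (e u v)) (e′ u v)
          r₁ , r₂ = graftRoot-injective {t = tree x} {tree x′} {tree y} {tree y′} {f} {f′} e″
                      (root x) (root x′) c c′ (trans (sym er) er′)
      in (graft-injective₁ {t₁ = tree x} {tree x′} {tree y} {tree y′} {f} {f′} e″ , r₁)
         , (graft-injective₂ {t₁ = tree x} {tree x′} {tree y} {tree y′} {f} {f′} e″ , r₂)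
  ; ∙-cong       = λ { {_} {_} {rooted x r₁} {rooted x′ .r₁} {rooted y r₂} {rooted y′ .r₂} {t} (ex , refl) (ey , refl) i →
      let f , c , e , er = ∈ᴿ⁻ (rooted x r₁) (rooted y r₂) {t} i
          module C = CongT {x = x} {x′} {y} {y′} ex ey f
      in ∈ᴿ⁺ (rooted x′ r₁) (rooted y′ r₂) {t} C.f′ (consistent-cong {x = x} {x′} {y} {y′} ex ey {f} r₁ r₂ c)
           ((λ u v → trans (e u v) (C.equal u v)) , er) }
  ; ∙-natural    = λ { {_} {_} {_} {_} σ τ {rooted x r₁} {rooted y r₂} {t} i →
      let f , c , e , er = ∈ᴿ⁻ (rooted x r₁) (rooted y r₂) {t} i
          module N = NaturalT σ τ x y f
      in ∈ᴿ⁺ (relabelᴿ (σ ⊕ᵇ idᵇ) (rooted x r₁)) (relabelᴿ τ (rooted y r₂)) {relabelᴿ (σ ⊕ᵇ τ) t}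
           N.f′ (consistent-natural σ τ x y f r₁ r₂ c)
           ((λ u v → trans (e (from (σ ⊕ᵇ τ) u) (from (σ ⊕ᵇ τ) v)) (N.equal u v))
           , trans (cong (to (σ ⊕ᵇ τ)) er) (graftRoot-natural σ τ r₁ r₂)) }
  ; ∙-unitˡ⁺     = λ { (inj₂ tt , u) (rooted y r) →
      ∈ᴿ⁺ (vertexᴿ (∅ ⊕ •) (inj₂ tt , u)) (rooted y r) {relabelᴿ (identityˡᵇ ⁻¹) (rooted y r)} (λ ()) (λ ())
        (UnitˡT.equal (inj₂ tt , u) y (λ ()) , refl) }
  ; ∙-unitˡ⁻     = λ { (inj₂ tt , u) (rooted y r) {t} i →
      let f , c , e , er = ∈ᴿ⁻ (vertexᴿ (∅ ⊕ •) (inj₂ tt , u)) (rooted y r) {t} i in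
      (λ v w → trans (e v w) (sym (UnitˡT.equal (inj₂ tt , u) y f v w))) , er }
  ; ∙-unitʳ⁺     = λ {W} {V} w (rooted x r) →
      ∈ᴿ⁺ (rooted x r) (vertexᴿ W w) {relabelᴿ (idᵇ ⊕ᵇ singletonᵇ w) (rooted x r)} (λ _ _ → proj₁ w) (λ _ _ → refl)
        (UnitʳT.equal {V} {W} w x (λ _ _ → proj₁ w) , unit-root V W w r)
  ; ∙-unitʳ⁻     = λ {W} {V} w (rooted x r) {t} i →
      let f , c , e , er = ∈ᴿ⁻ (rooted x r) (vertexᴿ W w) {t} i in
      (λ u v → trans (e u v) (sym (UnitʳT.equal {V} {W} w x f u v))) , trans er (sym (unit-root V W w r))
  ; ∙-assoc⁺     = λ { {V} {W} {Z} (rooted x rx) (rooted y ry) (rooted z rz) {rooted s rs} {t} i j → assoc⁺ x y z rx ry rz s rs t i j }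
  ; ∙-assoc⁻     = λ { {V} {W} {Z} (rooted x rx) (rooted y ry) (rooted z rz) {rooted r rr} {t} i j → assoc⁻ x y z rx ry rz r rr t i j }
  ; ∙-exchange   = λ { {V} {W} {Z} (rooted x rx) (rooted y ry) (rooted z rz) {rooted s rs} {t} i j → exch x y z rx ry rz s rs t i j }
  }
  where
  unit-root : ∀ V W (w : Singleton W) (r : ∣ V ⊕ • ∣) → to (idᵇ {V} ⊕ᵇ singletonᵇ {W} w) r ≡ graftRoot r (proj₁ w)
  unit-root V W w (inj₁ _) = refl
  unit-root V W w (inj₂ _) = refl

  module _ {V W Z : FinSet} where

    assoc⁺ : (x : Tree (V ⊕ •)) (y : Tree (W ⊕ •)) (z : Tree Z) → ∀ rx ry rz (s : Tree (V ⊕ (W ⊕ •))) rs t →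
             Any (rooted s rs ≈ᴿ_) (rooted x rx ∘ᴿ rooted y ry) →
             Any (t ≈ᴿ_) (relabelᴿ (assocᵇ ⁻¹) (rooted s rs) ∘ᴿ rooted z rz) →
             ∃[ r ] Any (r ≈ᴿ_) (rooted y ry ∘ᴿ rooted z rz) × Any (relabelᴿ assocᵇ t ≈ᴿ_) (rooted x rx ∘ᴿ r)
    assoc⁺ x y z rx ry rz s rs t i j with ∈ᴿ⁻ (rooted x rx) (rooted y ry) {rooted s rs} i
    ... | f , cf , e , refl with ∈ᴿ⁻ (relabelᴿ (assocᵇ ⁻¹) (rooted s rs)) (rooted z rz) {t} j
    ... | g₀ , c₀ , e₀ , er₀ = r
         , ∈ᴿ⁺ (rooted y ry) (rooted z rz) {r} (A.g′ f g) (R.consistent-g′ cg) ((λ _ _ → refl) , refl)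
         , ∈ᴿ⁺ (rooted x rx) r {relabelᴿ assocᵇ t} (A.f′ f g) (R.consistent-f′ cg)
             ((λ u v → trans (trans (e₀ (Sum.assocˡ u) (Sum.assocˡ v)) (C.equal (Sum.assocˡ u) (Sum.assocˡ v))) (A.equal f g u v))
             , trans (cong Sum.assocʳ er₀) R.root-≡)
      where
      s≈ : relabel (assocᵇ ⁻¹) s ≈ᵀ relabel (assocᵇ ⁻¹) (graft x y f)
      s≈ u v = e (Sum.assocʳ u) (Sum.assocʳ v)
      module C = CongT {x = relabel (assocᵇ ⁻¹) s} {relabel (assocᵇ ⁻¹) (graft x y f)} {z} {z} s≈ (λ _ _ → refl) g₀
      g = C.f′
      module A = AssocT x y z
      module R = AssocR x y z rx ry rz f g cf
      cg : Consistent {W = Z} R.s R.rs rz g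
      cg = consistent-cong {x = relabel (assocᵇ ⁻¹) s} {relabel (assocᵇ ⁻¹) (graft x y f)} {z} {z} s≈ (λ _ _ → refl) {g₀} R.rs rz c₀
      r = rooted (graft y z (A.g′ f g)) (graftRoot ry rz)

    assoc⁻ : (x : Tree (V ⊕ •)) (y : Tree (W ⊕ •)) (z : Tree Z) → ∀ rx ry rz (r : Tree (W ⊕ Z)) rr t →
             Any (rooted r rr ≈ᴿ_) (rooted y ry ∘ᴿ rooted z rz) →
             Any (t ≈ᴿ_) (rooted x rx ∘ᴿ rooted r rr) →
             ∃[ s ] Any (s ≈ᴿ_) (rooted x rx ∘ᴿ rooted y ry)
                    × Any (relabelᴿ (assocᵇ ⁻¹) t ≈ᴿ_) (relabelᴿ (assocᵇ ⁻¹) s ∘ᴿ rooted z rz)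
    assoc⁻ x y z rx ry rz r rr t i j with ∈ᴿ⁻ (rooted y ry) (rooted z rz) {rooted r rr} i
    ... | k , ck , e , refl with ∈ᴿ⁻ (rooted x rx) (rooted r rr) {t} j
    ... | h₀ , c₀ , e₀ , er₀ = s
         , ∈ᴿ⁺ (rooted x rx) (rooted y ry) {s} f cf ((λ _ _ → refl) , refl)
         , ∈ᴿ⁺ (relabelᴿ (assocᵇ ⁻¹) s) (rooted z rz) {relabelᴿ (assocᵇ ⁻¹) t} g cg
             ((λ u v → trans (trans (e₀ (Sum.assocʳ u) (Sum.assocʳ v)) (C.equal (Sum.assocʳ u) (Sum.assocʳ v))) (A.equal⁻ k h u v))
             , trans (cong Sum.assocˡ (trans er₀ (sym R.root-≡))) (strictlyInverseʳ (assocᵇ {V} {W} {Z}) _))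
      where
      module C = CongT {x = x} {x} {r} {graft y z k} (λ _ _ → refl) e h₀
      h = C.f′
      ch : Consistent {W = W ⊕ Z} x rx (graftRoot ry rz) h
      ch = consistent-cong {x = x} {x} {r} {graft y z k} (λ _ _ → refl) e {h₀} rx (graftRoot ry rz) c₀
      module A = AssocT x y z
      f = A.f⁻ k h
      g = A.g⁻ k h
      s = rooted (graft x y f) (graftRoot rx ry)

      contract-root : ∀ ry → A.contract k h (graftRoot ry rz) ≡ ry
      contract-root (inj₁ _) = refl
      contract-root (inj₂ _) = refl

      cf : Consistent {W = W ⊕ •} x rx ry f
      cf u q = trans (cong (A.contract k h) (ch u q)) (contract-root ry)

      module R = AssocR x y z rx ry rz f g cf

      fromZ-root : ∀ ry v .(p : A.contract k h v ≡ inj₂ tt) → ry ≡ inj₂ tt → v ≡ graftRoot ry rz → A.fromZ k h v p ≡ rz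
      fromZ-root (inj₂ _) (inj₂ _) p e refl = refl

      cg : Consistent {W = Z} R.s R.rs rz g
      cg = R.consistent-g
        (λ {w} q p → ck w q)
        (λ e {u} q p → fromZ-root ry _ (proj₂ (attached⁻ (W ⊕ •) _ (f u) p)) e (ch u q))

    exch : (x : Tree ((V ⊕ •) ⊕ •)) (y : Tree W) (z : Tree Z) → ∀ rx ry rz (s : Tree ((V ⊕ •) ⊕ W)) rs t →
           Any (rooted s rs ≈ᴿ_) (rooted x rx ∘ᴿ rooted y ry) →
           Any (t ≈ᴿ_) (relabelᴿ exchangeᵇ (rooted s rs) ∘ᴿ rooted z rz) →
           ∃[ r ] Any (r ≈ᴿ_) (relabelᴿ exchangeᵇ (rooted x rx) ∘ᴿ rooted z rz)
                  × Any (relabelᴿ exchangeᵇ t ≈ᴿ_) (relabelᴿ exchangeᵇ r ∘ᴿ rooted y ry)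
    exch x y z rx ry rz s rs t i j with ∈ᴿ⁻ (rooted x rx) (rooted y ry) {rooted s rs} i
    ... | f , cf , e , refl with ∈ᴿ⁻ (relabelᴿ exchangeᵇ (rooted s rs)) (rooted z rz) {t} j
    ... | g₀ , c₀ , e₀ , er₀ = r
         , ∈ᴿ⁺ (relabelᴿ exchangeᵇ (rooted x rx)) (rooted z rz) {r} E.f′ R.consistent-f′ ((λ _ _ → refl) , refl)
         , ∈ᴿ⁺ (relabelᴿ exchangeᵇ r) (rooted y ry) {relabelᴿ exchangeᵇ t} E.g′ R.consistent-g′
             ((λ u v → trans (trans (e₀ (exchange u) (exchange v)) (C.equal (exchange u) (exchange v))) (E.equal u v))
             , trans (cong exchange er₀) R.root-≡)
      where
      s≈ : relabel exchangeᵇ s ≈ᵀ relabel exchangeᵇ (graft x y f)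
      s≈ u v = e (exchange u) (exchange v)
      module C = CongT {x = relabel exchangeᵇ s} {relabel exchangeᵇ (graft x y f)} {z} {z} s≈ (λ _ _ → refl) g₀
      g = C.f′
      module E = ExchangeT x y z f g
      cg : Consistent {W = Z} (relabel exchangeᵇ (graft x y f)) (exchange (graftRoot rx ry)) rz g
      cg = consistent-cong {x = relabel exchangeᵇ s} {relabel exchangeᵇ (graft x y f)} {z} {z} s≈ (λ _ _ → refl) {g₀}
             (exchange (graftRoot rx ry)) rz c₀
      module R = ExchangeConsistent x y z rx ry rz f g cf cg
      r = rooted (graft E.x′ z E.f′) (graftRoot (exchange rx) rz)

module _ (S : Setoid 0ℓ 0ℓ) where

  open Setoid S using (Carrier; _≈_) renaming (refl to ≈-refl; sym to ≈-sym; trans to ≈-trans)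

  private
    _∈_ : Carrier → List Carrier → Set
    x ∈ xs = Any (x ≈_) xs

    Distinct : List Carrier → Set
    Distinct = AllPairs (λ x y → ¬ (x ≈ y))

  ∈-resp : ∀ {x y xs} → x ≈ y → x ∈ xs → y ∈ xs
  ∈-resp e = Any.map (≈-trans (≈-sym e))

  find : ∀ {P : Carrier → Set} {xs} → Any P xs → ∃[ x ] x ∈ xs × P x
  find (here p)  = _ , here ≈-refl , p
  find (there i) = let x , j , p = find i in x , there j , p

  removed : ∀ {x t} {xs} (i : x ∈ xs) → t ∈ xs → (t ≈ x) ⊎ (t ∈ (xs Any.─ i))
  removed (here p)  (here q)  = inj₁ (≈-trans q (≈-sym p))
  removed (here p)  (there j) = inj₂ j
  removed (there i) (here q)  = inj₂ (here q)
  removed (there i) (there j) = Sum.map₂ there (removed i j)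

  remains : ∀ {x t} {xs} (i : x ∈ xs) → t ∈ (xs Any.─ i) → t ∈ xs
  remains (here p)  j         = there j
  remains (there i) (here q)  = here q
  remains (there i) (there j) = there (remains i j)

  all-remains : ∀ {P : Carrier → Set} {x} {xs} (i : x ∈ xs) → All P xs → All P (xs Any.─ i)
  all-remains (here _)  (_ ∷ ps) = ps
  all-remains (there i) (p ∷ ps) = p ∷ all-remains i ps

  distinct-remains : ∀ {x} {xs} (i : x ∈ xs) → Distinct xs → Distinct (xs Any.─ i)
  distinct-remains (here _)  (_ ∷ d) = d
  distinct-remains (there i) (p ∷ d) = all-remains i p ∷ distinct-remains i d

  lookup-all : ∀ {P : Carrier → Set} {x xs} → (∀ {y} → x ≈ y → P y → P x) → All P xs → x ∈ xs → P x
  lookup-all r (p ∷ ps) (here q)  = r q p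
  lookup-all r (p ∷ ps) (there i) = lookup-all r ps i

  gone : ∀ {x t} {xs} (i : x ∈ xs) → Distinct xs → t ∈ (xs Any.─ i) → ¬ (t ≈ x)
  gone (here p)  (q ∷ d) j         e = lookup-all (λ e′ n e″ → n (≈-trans e″ e′)) q j (≈-sym (≈-trans e p))
  gone (there i) (q ∷ d) (here p)  e = lookup-all (λ e′ n e″ → n (≈-trans e″ e′)) q i (≈-trans (≈-sym p) e)
  gone (there i) (q ∷ d) (there j) e = gone i d j e

module _ (S T : Setoid 0ℓ 0ℓ) where

  private
    module S = Setoid S
    module T = Setoid T

  concatMap-distinct : (f : S.Carrier → List T.Carrier) → (∀ x → AllPairs (λ y z → ¬ (y T.≈ z)) (f x)) →
                       (∀ {x y t} → Any (t T.≈_) (f x) → Any (t T.≈_) (f y) → x S.≈ y) →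
                       ∀ {xs} → AllPairs (λ x y → ¬ (x S.≈ y)) xs → AllPairs (λ y z → ¬ (y T.≈ z)) (concatMap f xs)
  concatMap-distinct f u inj []       = []
  concatMap-distinct f u inj {x ∷ xs} (p ∷ d) = AllPairsP.++⁺ (u x) (concatMap-distinct f u inj d)
    (All.tabulateₛ T {xs = f x} λ {t} i → AllP.¬Any⇒All¬ _ λ j →
      let _ , k , l = find S (AnyP.concatMap⁻ f {xs = xs} j) in
      lookup-all S (λ e′ n e″ → n (S.trans e″ e′)) p k (inj i l))

-- A field with decidable equality is a HeytingField whose apartness is the
-- negation of its equality.
module _ (K : HeytingField c ℓ₁ ℓ₂) where

  private
    R : CommutativeRing c ℓ₁
    R = HeytingCommutativeRing.commutativeRing (HeytingField.heytingCommutativeRing K)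

    module R = CommutativeRing R
    𝕂 : Set c
    𝕂 = R.Carrier

  CharacteristicZero : Set ℓ₁
  CharacteristicZero = ∀ n → ¬ (suc n times R.1# R.≈ R.0#)
    where open Mult R.+-monoid using () renaming (_×_ to _times_)

  VectorSpace : ∀ m ℓ → Set (c ⊔ ℓ₁ ⊔ lsuc (m ⊔ ℓ))
  VectorSpace m ℓ = Module R m ℓ

  module _ {m ℓ m′ ℓ′} (M : VectorSpace m ℓ) (N : VectorSpace m′ ℓ′) where

    private
      module M = Module M
      module N = Module N

    IsLinear : (M.Carrierᴹ → N.Carrierᴹ) → Set (c ⊔ m ⊔ ℓ ⊔ ℓ′)
    IsLinear = ModuleMorphisms.IsModuleHomomorphism M.rawModule N.rawModule

    linear : {f : M.Carrierᴹ → N.Carrierᴹ} →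
             (∀ {x y} → x M.≈ᴹ y → f x N.≈ᴹ f y) →
             (∀ x y → f (x M.+ᴹ y) N.≈ᴹ f x N.+ᴹ f y) →
             f M.0ᴹ N.≈ᴹ N.0ᴹ →
             (∀ x → f (M.-ᴹ x) N.≈ᴹ N.-ᴹ f x) →
             (∀ k x → f (k M.*ₗ x) N.≈ᴹ k N.*ₗ f x) → IsLinear f
    linear cong +-homo 0-homo neg-homo *-homo = record { isBimoduleHomomorphism = record
      { +ᴹ-isGroupHomomorphism = record
        { isMonoidHomomorphism = record
          { isMagmaHomomorphism = record { isRelHomomorphism = record { cong = cong } ; homo = +-homo }
          ; ε-homo = 0-homo
          }
        ; ⁻¹-homo = neg-homo
        }
      ; *ₗ-homo = *-homo
      ; *ᵣ-homo = λ k x → N.≈ᴹ-trans (cong (M.≈ᴹ-sym (M.*ₗ-*ᵣ-coincident k x)))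
                            (N.≈ᴹ-trans (*-homo k x) (N.*ₗ-*ᵣ-coincident k _))
      } }

  record Species m ℓ : Set (c ⊔ ℓ₁ ⊔ lsuc (m ⊔ ℓ)) where
    field
      space : FinSet → VectorSpace m ℓ

    ⟦_⟧ : FinSet → Set m
    ⟦ V ⟧ = Module.Carrierᴹ (space V)

    infix 4 _≈_
    _≈_ : Rel ⟦ V ⟧ ℓ
    _≈_ {V} = Module._≈ᴹ_ (space V)

    field
      map        : V ≅ W → ⟦ V ⟧ → ⟦ W ⟧
      map-linear : (σ : V ≅ W) → IsLinear (space V) (space W) (map σ)
      map-ext    : {σ τ : V ≅ W} → (∀ v → to σ v ≡ to τ v) → (x : ⟦ V ⟧) → map σ x ≈ map τ x
      map-id     : (x : ⟦ V ⟧) → map idᵇ x ≈ x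
      map-∘      : (σ : V ≅ W) (τ : U ≅ V) (x : ⟦ U ⟧) → map (σ ∘ᵇ τ) x ≈ map σ (map τ x)

  -- The element * of V₁ ⊔ {*} is inj₂ tt ∈ V ⊕ •; elements of a vector space
  -- O[(V₁ ⊔ V₂) ⊔ V₃] are compared with those of O[V₁ ⊔ (V₂ ⊔ V₃)] and so on along
  -- the canonical bijections.
  record Operad m ℓ : Set (c ⊔ ℓ₁ ⊔ lsuc (m ⊔ ℓ)) where
    infixl 7 _∘*_
    field
      species : Species m ℓ

    open Species species public

    field
      vanishing    : ¬ ∣ V ∣ → (x : ⟦ V ⟧) → x ≈ Module.0ᴹ (space V)
      e            : ∀ V → Singleton V → ⟦ V ⟧
      e-natural    : (σ : V ≅ W) (v : Singleton V) (w : Singleton W) → map σ (e V v) ≈ e W w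
      _∘*_         : ⟦ V ⊕ • ⟧ → ⟦ W ⟧ → ⟦ V ⊕ W ⟧
      ∘-linearˡ    : (y : ⟦ W ⟧) → IsLinear (space (V ⊕ •)) (space (V ⊕ W)) (_∘* y)
      ∘-linearʳ    : (x : ⟦ V ⊕ • ⟧) → IsLinear (space W) (space (V ⊕ W)) (x ∘*_)
      ∘-natural    : (σ : V ≅ V′) (τ : W ≅ W′) (x : ⟦ V ⊕ • ⟧) (y : ⟦ W ⟧) →
                     map (σ ⊕ᵇ τ) (x ∘* y) ≈ map (σ ⊕ᵇ idᵇ) x ∘* map τ y
      ∘-sequential : (x : ⟦ V ⊕ • ⟧) (y : ⟦ W ⊕ • ⟧) (z : ⟦ Z ⟧) →
                     map assocᵇ (map (assocᵇ ⁻¹) (x ∘* y) ∘* z) ≈ x ∘* (y ∘* z)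
      ∘-parallel   : (x : ⟦ (V ⊕ •) ⊕ • ⟧) (y : ⟦ W ⟧) (z : ⟦ Z ⟧) →
                     map exchangeᵇ (x ∘* y) ∘* z ≈ map exchangeᵇ (map exchangeᵇ (map exchangeᵇ x ∘* z) ∘* y)
      ∘-unitˡ      : (v : Singleton (∅ ⊕ •)) (y : ⟦ V ⟧) → map identityˡᵇ (e (∅ ⊕ •) v ∘* y) ≈ y
      ∘-unitʳ      : (w : Singleton W) (x : ⟦ V ⊕ • ⟧) → x ∘* e W w ≈ map (idᵇ ⊕ᵇ singletonᵇ w) x

  module _ {m ℓ m′ ℓ′} (O : Operad m ℓ) (P : Operad m′ ℓ′) where

    private
      module O = Operad O
      module P = Operad P

    record IsOperadMorphism (φ : ∀ V → O.⟦ V ⟧ → P.⟦ V ⟧) : Set (c ⊔ m ⊔ ℓ ⊔ ℓ′ ⊔ lsuc 0ℓ) where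
      field
        isLinear : ∀ V → IsLinear (O.space V) (P.space V) (φ V)
        natural  : (σ : V ≅ W) (x : O.⟦ V ⟧) → φ W (O.map σ x) P.≈ P.map σ (φ V x)
        e-homo   : (v : Singleton V) → φ V (O.e V v) P.≈ P.e V v
        ∘-homo   : (x : O.⟦ V ⊕ • ⟧) (y : O.⟦ W ⟧) → φ (V ⊕ W) (x O.∘* y) P.≈ φ (V ⊕ •) x P.∘* φ W y

    record IsOperadMonomorphism (φ : ∀ V → O.⟦ V ⟧ → P.⟦ V ⟧) : Set (c ⊔ m ⊔ ℓ ⊔ ℓ′ ⊔ lsuc 0ℓ) where
      field
        isOperadMorphism : IsOperadMorphism φ
        injective        : ∀ V → Injective O._≈_ P._≈_ (φ V)

      open IsOperadMorphism isOperadMorphism public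

  -- The vector space with basis X: formal linear combinations of elements of X,
  -- up to the vector space axioms and the equality of X.

  module _ (X : Setoid 0ℓ 0ℓ) where

    private module X = Setoid X

    infixl 6 _⊞_
    infixr 7 _·_
    infix  4 _≋_

    data Free : Set c where
      𝟎    : Free
      _⊞_  : Free → Free → Free
      _·_  : 𝕂 → Free → Free
      [_]  : X.Carrier → Free

    data _≋_ : Rel Free (c ⊔ ℓ₁) where
      ≋-refl      : ∀ {a} → a ≋ a
      ≋-sym       : ∀ {a b} → a ≋ b → b ≋ a
      ≋-trans     : ∀ {a b d} → a ≋ b → b ≋ d → a ≋ d
      ⊞-cong      : ∀ {a a′ b b′} → a ≋ a′ → b ≋ b′ → a ⊞ b ≋ a′ ⊞ b′
      ·-cong      : ∀ {k l a b} → k R.≈ l → a ≋ b → k · a ≋ l · b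
      []-cong     : ∀ {x y} → x X.≈ y → [ x ] ≋ [ y ]
      ⊞-assoc     : ∀ a b d → (a ⊞ b) ⊞ d ≋ a ⊞ (b ⊞ d)
      ⊞-comm      : ∀ a b → a ⊞ b ≋ b ⊞ a
      ⊞-identityˡ : ∀ a → 𝟎 ⊞ a ≋ a
      ·-zeroˡ     : ∀ a → R.0# · a ≋ 𝟎
      ·-zeroʳ     : ∀ k → k · 𝟎 ≋ 𝟎
      ·-distribˡ  : ∀ k a b → k · (a ⊞ b) ≋ k · a ⊞ k · b
      ·-distribʳ  : ∀ a k l → (k R.+ l) · a ≋ k · a ⊞ l · a
      ·-assoc     : ∀ k l a → (k R.* l) · a ≋ k · l · a
      ·-identity  : ∀ a → R.1# · a ≋ a

    private
      negate : Free → Free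
      negate a = (R.- R.1#) · a

      inverseˡ : ∀ a → negate a ⊞ a ≋ 𝟎
      inverseˡ a = ≋-trans (⊞-cong ≋-refl (≋-sym (·-identity a)))
        (≋-trans (≋-sym (·-distribʳ a (R.- R.1#) R.1#)) (≋-trans (·-cong (R.-‿inverseˡ R.1#) ≋-refl) (·-zeroˡ a)))

    free : VectorSpace c (c ⊔ ℓ₁)
    free = record
      { Carrierᴹ = Free ; _≈ᴹ_ = _≋_ ; _+ᴹ_ = _⊞_ ; _*ₗ_ = _·_ ; _*ᵣ_ = λ a k → k · a ; 0ᴹ = 𝟎 ; -ᴹ_ = negate
      ; isModule = record
        { isBimodule = record
          { isBisemimodule = record
            { +ᴹ-isCommutativeMonoid = record
              { isMonoid = record
                { isSemigroup = record
                  { isMagma = record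
                    { isEquivalence = record { refl = ≋-refl ; sym = ≋-sym ; trans = ≋-trans }
                    ; ∙-cong = ⊞-cong
                    }
                  ; assoc = ⊞-assoc
                  }
                ; identity = ⊞-identityˡ , λ a → ≋-trans (⊞-comm a 𝟎) (⊞-identityˡ a)
                }
              ; comm = ⊞-comm
              }
            ; isPreleftSemimodule = record
              { *ₗ-cong = ·-cong ; *ₗ-zeroˡ = ·-zeroˡ ; *ₗ-distribʳ = ·-distribʳ ; *ₗ-identityˡ = ·-identity
              ; *ₗ-assoc = ·-assoc ; *ₗ-zeroʳ = ·-zeroʳ ; *ₗ-distribˡ = ·-distribˡ
              }
            ; isPrerightSemimodule = record
              { *ᵣ-cong = λ p q → ·-cong q p ; *ᵣ-zeroʳ = ·-zeroˡ ; *ᵣ-distribˡ = ·-distribʳ ; *ᵣ-identityʳ = ·-identity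
              ; *ᵣ-assoc = λ a k l → ≋-trans (≋-sym (·-assoc l k a)) (·-cong (R.*-comm l k) ≋-refl)
              ; *ᵣ-zeroˡ = ·-zeroʳ ; *ᵣ-distribʳ = λ k a b → ·-distribˡ k a b
              }
            ; *ₗ-*ᵣ-assoc = λ k a l → ≋-trans (≋-sym (·-assoc l k a)) (≋-trans (·-cong (R.*-comm l k) ≋-refl) (·-assoc k l a))
            }
          ; -ᴹ‿cong = ·-cong R.refl
          ; -ᴹ‿inverse = inverseˡ , λ a → ≋-trans (⊞-comm a (negate a)) (inverseˡ a)
          }
        ; *ₗ-*ᵣ-coincident = λ _ _ → ≋-refl
        }
      }

    ∑ : List X.Carrier → Free
    ∑ = foldr (λ x a → [ x ] ⊞ a) 𝟎

  -- Linear extension of a map defined on a basis.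
  extend : {X Y : Setoid 0ℓ 0ℓ} → (Setoid.Carrier X → Free Y) → Free X → Free Y
  extend f 𝟎       = 𝟎
  extend f (a ⊞ b) = extend f a ⊞ extend f b
  extend f (k · a) = k · extend f a
  extend f [ x ]   = f x

  module _ {X Y : Setoid 0ℓ 0ℓ} where

    private
      module X = Setoid X
      module Y = Setoid Y
      Map : Set c
      Map = X.Carrier → Free Y

    extend-cong : {f : Map} → (∀ {x y} → x X.≈ y → _≋_ Y (f x) (f y)) → ∀ {a b} → _≋_ X a b → _≋_ Y (extend f a) (extend f b)
    extend-cong f-cong ≋-refl            = ≋-refl
    extend-cong f-cong (≋-sym p)         = ≋-sym (extend-cong f-cong p)
    extend-cong f-cong (≋-trans p q)     = ≋-trans (extend-cong f-cong p) (extend-cong f-cong q)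
    extend-cong f-cong (⊞-cong p q)      = ⊞-cong (extend-cong f-cong p) (extend-cong f-cong q)
    extend-cong f-cong (·-cong p q)      = ·-cong p (extend-cong f-cong q)
    extend-cong f-cong ([]-cong p)       = f-cong p
    extend-cong f-cong (⊞-assoc a b d)   = ⊞-assoc _ _ _
    extend-cong f-cong (⊞-comm a b)      = ⊞-comm _ _
    extend-cong f-cong (⊞-identityˡ a)   = ⊞-identityˡ _
    extend-cong f-cong (·-zeroˡ a)       = ·-zeroˡ _
    extend-cong f-cong (·-zeroʳ k)       = ·-zeroʳ k
    extend-cong f-cong (·-distribˡ k a b) = ·-distribˡ k _ _
    extend-cong f-cong (·-distribʳ a k l) = ·-distribʳ _ k l
    extend-cong f-cong (·-assoc k l a)   = ·-assoc k l _
    extend-cong f-cong (·-identity a)    = ·-identity _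

    extend-linear : {f : Map} → (∀ {x y} → x X.≈ y → _≋_ Y (f x) (f y)) → IsLinear (free X) (free Y) (extend f)
    extend-linear f-cong = linear (free X) (free Y) (extend-cong f-cong)
      (λ _ _ → ≋-refl) ≋-refl (λ _ → ≋-refl) (λ _ _ → ≋-refl)

    extend-ext : {f g : Map} → (∀ x → _≋_ Y (f x) (g x)) → (a : Free X) → _≋_ Y (extend f a) (extend g a)
    extend-ext e 𝟎       = ≋-refl
    extend-ext e (a ⊞ b) = ⊞-cong (extend-ext e a) (extend-ext e b)
    extend-ext e (k · a) = ·-cong R.refl (extend-ext e a)
    extend-ext e [ x ]   = e x

    extend-𝟎 : ∀ a → _≋_ Y (extend {X} (λ _ → 𝟎) a) 𝟎
    extend-𝟎 𝟎       = ≋-refl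
    extend-𝟎 (a ⊞ b) = ≋-trans (⊞-cong (extend-𝟎 a) (extend-𝟎 b)) (⊞-identityˡ 𝟎)
    extend-𝟎 (k · a) = ≋-trans (·-cong R.refl (extend-𝟎 a)) (·-zeroʳ k)
    extend-𝟎 [ x ]   = ≋-refl

    extend-⊞ : (f g : Map) (a : Free X) → _≋_ Y (extend (λ x → f x ⊞ g x) a) (extend f a ⊞ extend g a)
    extend-⊞ f g 𝟎       = ≋-sym (⊞-identityˡ 𝟎)
    extend-⊞ f g (a ⊞ b) = ≋-trans (⊞-cong (extend-⊞ f g a) (extend-⊞ f g b))
      (≋-trans (⊞-assoc _ _ _) (≋-trans (⊞-cong ≋-refl
        (≋-trans (≋-sym (⊞-assoc _ _ _)) (≋-trans (⊞-cong (⊞-comm _ _) ≋-refl) (⊞-assoc _ _ _))))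
        (≋-sym (⊞-assoc _ _ _))))
    extend-⊞ f g (k · a) = ≋-trans (·-cong R.refl (extend-⊞ f g a)) (·-distribˡ k _ _)
    extend-⊞ f g [ x ]   = ≋-refl

    extend-· : ∀ l (f : Map) (a : Free X) → _≋_ Y (extend (λ x → l · f x) a) (l · extend f a)
    extend-· l f 𝟎       = ≋-sym (·-zeroʳ l)
    extend-· l f (a ⊞ b) = ≋-trans (⊞-cong (extend-· l f a) (extend-· l f b)) (≋-sym (·-distribˡ l _ _))
    extend-· l f (k · a) = ≋-trans (·-cong R.refl (extend-· l f a))
      (≋-trans (≋-sym (·-assoc k l _)) (≋-trans (·-cong (R.*-comm k l) ≋-refl) (·-assoc l k _)))
    extend-· l f [ x ]   = ≋-refl

  module _ {X : Setoid 0ℓ 0ℓ} where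

    -- Linear maps that agree on a basis are equal.
    linear-ext : {m ℓ : Level} (M : VectorSpace m ℓ) {φ χ : Free X → Module.Carrierᴹ M} →
                 IsLinear (free X) M φ → IsLinear (free X) M χ →
                 (∀ x → Module._≈ᴹ_ M (φ [ x ]) (χ [ x ])) → ∀ a → Module._≈ᴹ_ M (φ a) (χ a)
    linear-ext M {φ} {χ} p q e = go
      where
      module M = Module M
      module P = ModuleMorphisms.IsModuleHomomorphism p
      module Q = ModuleMorphisms.IsModuleHomomorphism q
      go : ∀ a → φ a M.≈ᴹ χ a
      go 𝟎       = M.≈ᴹ-trans P.0ᴹ-homo (M.≈ᴹ-sym Q.0ᴹ-homo)
      go (a ⊞ b) = M.≈ᴹ-trans (P.+ᴹ-homo a b) (M.≈ᴹ-trans (M.+ᴹ-cong (go a) (go b)) (M.≈ᴹ-sym (Q.+ᴹ-homo a b)))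
      go (k · a) = M.≈ᴹ-trans (P.*ₗ-homo k a) (M.≈ᴹ-trans (M.*ₗ-cong R.refl (go a)) (M.≈ᴹ-sym (Q.*ₗ-homo k a)))
      go [ x ]   = e x

  module _ {X : Setoid 0ℓ 0ℓ} where

    private module X = Setoid X

    ∑-remove : ∀ {x xs} (i : Any (x X.≈_) xs) → _≋_ X (∑ X xs) ([ x ] ⊞ ∑ X (xs Any.─ i))
    ∑-remove (here p)  = ⊞-cong ([]-cong (X.sym p)) ≋-refl
    ∑-remove (there i) = ≋-trans (⊞-cong ≋-refl (∑-remove i)) (≋-trans (≋-sym (⊞-assoc _ _ _))
      (≋-trans (⊞-cong (⊞-comm _ _) ≋-refl) (⊞-assoc _ _ _)))

    -- The sum of a list without repetitions depends only on its set of entries.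
    ∑-cong : ∀ {xs ys} → AllPairs (λ x y → ¬ (x X.≈ y)) xs → AllPairs (λ x y → ¬ (x X.≈ y)) ys →
             (∀ {t} → Any (t X.≈_) xs → Any (t X.≈_) ys) → (∀ {t} → Any (t X.≈_) ys → Any (t X.≈_) xs) →
             _≋_ X (∑ X xs) (∑ X ys)
    ∑-cong {[]} {[]}     d d′ f g = ≋-refl
    ∑-cong {[]} {y ∷ ys} d d′ f g with g (here X.refl)
    ... | ()
    ∑-cong {x ∷ xs} {ys} (p ∷ d) d′ f g = ≋-trans
      (⊞-cong ≋-refl (∑-cong d (distinct-remains X i d′) f′ g′))
      (≋-sym (∑-remove i))
      where
      i = f (here X.refl)
      f′ : ∀ {t} → Any (t X.≈_) xs → Any (t X.≈_) (ys Any.─ i)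
      f′ j with removed X i (f (there j))
      ... | inj₁ e = ⊥-elim (AllP.All¬⇒¬Any p (∈-resp X e j))
      ... | inj₂ k = k
      g′ : ∀ {t} → Any (t X.≈_) (ys Any.─ i) → Any (t X.≈_) xs
      g′ j with g (remains X i j)
      ... | here e  = ⊥-elim (gone X i d′ j e)
      ... | there k = k

    ∑-++ : ∀ xs ys → _≋_ X (∑ X (xs ++ ys)) (∑ X xs ⊞ ∑ X ys)
    ∑-++ []       ys = ≋-sym (⊞-identityˡ _)
    ∑-++ (x ∷ xs) ys = ≋-trans (⊞-cong ≋-refl (∑-++ xs ys)) (≋-sym (⊞-assoc _ _ _))

  module _ {X Y : Setoid 0ℓ 0ℓ} where

    private
      module X = Setoid X
      module Y = Setoid Y

    extend-∑ : (f : X.Carrier → List Y.Carrier) → ∀ xs →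
               _≋_ Y (extend (λ x → ∑ Y (f x)) (∑ X xs)) (∑ Y (concatMap f xs))
    extend-∑ f []       = ≋-refl
    extend-∑ f (x ∷ xs) = ≋-trans (⊞-cong ≋-refl (extend-∑ f xs)) (≋-sym (∑-++ (f x) (concatMap f xs)))

    extend-∑-map : (f : X.Carrier → Y.Carrier) → ∀ xs →
                   _≋_ Y (extend (λ x → [ f x ]) (∑ X xs)) (∑ Y (List.map f xs))
    extend-∑-map f []       = ≋-refl
    extend-∑-map f (x ∷ xs) = ⊞-cong ≋-refl (extend-∑-map f xs)

  -- The operad with basis B, its compositions being the bilinear extensions of
  -- (x , y) ↦ ∑ (x ∙ y).
  module Linearisation (B : BasisOperad) where

    module B = BasisOperad B
    open B using (X; basis; rename; _∙_; _∈_) renaming (_≈_ to _≈ᵇ_)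

    module S {V} = Setoid (basis V)

    map : V ≅ W → Free (basis V) → Free (basis W)
    map σ = extend (λ x → [ rename σ x ])

    infixl 7 _∘*_
    _∘*_ : Free (basis (V ⊕ •)) → Free (basis W) → Free (basis (V ⊕ W))
    a ∘* b = extend (λ x → extend (λ y → ∑ _ (x ∙ y)) b) a

    Distinct : List (X V) → Set
    Distinct = AllPairs (λ x y → ¬ (x ≈ᵇ y))

    cancel : (σ : V ≅ W) (τ : W ≅ V) → (∀ w → to σ (to τ w) ≡ w) → (x : X W) → rename σ (rename τ x) ≈ᵇ x
    cancel σ τ e x = S.trans (S.sym (B.rename-∘ σ τ x)) (S.trans (B.rename-ext e x) (B.rename-id x))

    ∈-resp′ : {x y : X V} {xs : List (X V)} → x ≈ᵇ y → x ∈ xs → y ∈ xs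
    ∈-resp′ = ∈-resp (basis _)

    ∈-map⁺ : (σ : V ≅ W) (τ : W ≅ V) → (∀ w → to σ (to τ w) ≡ w) →
             ∀ {t xs} → rename τ t ∈ xs → t ∈ List.map (rename σ) xs
    ∈-map⁺ σ τ e i = AnyP.map⁺ (Any.map (λ p → S.trans (S.sym (cancel σ τ e _)) (B.rename-cong σ p)) i)

    ∈-map⁻ : (σ : V ≅ W) (τ : W ≅ V) → (∀ v → to τ (to σ v) ≡ v) →
             ∀ {t xs} → t ∈ List.map (rename σ) xs → rename τ t ∈ xs
    ∈-map⁻ σ τ e i = Any.map (λ p → S.trans (B.rename-cong τ p) (cancel τ σ e _)) (AnyP.map⁻ i)

    ∈-bind⁺ : (f : X V → List (X W)) {t : X W} → (∀ {s s′} → s ≈ᵇ s′ → t ∈ f s → t ∈ f s′) →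
              ∀ {s xs} → s ∈ xs → t ∈ f s → t ∈ concatMap f xs
    ∈-bind⁺ f resp i j = AnyP.concatMap⁺ f (Any.map (λ e → resp e j) i)

    ∈-bind⁻ : (f : X V → List (X W)) {t : X W} → ∀ {xs} → t ∈ concatMap f xs → ∃[ s ] s ∈ xs × t ∈ f s
    ∈-bind⁻ f {xs = xs} i = find (basis _) (AnyP.concatMap⁻ f {xs = xs} i)

    map-distinct : (σ : V ≅ W) {xs : List (X V)} → Distinct xs → Distinct (List.map (rename σ) xs)
    map-distinct σ d = AllPairsP.map⁺ (AllPairs.map (λ n e → n (S.trans (S.sym (cancel (σ ⁻¹) σ (strictlyInverseʳ σ) _))
      (S.trans (B.rename-cong (σ ⁻¹) e) (cancel (σ ⁻¹) σ (strictlyInverseʳ σ) _)))) d)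

    bindˡ-distinct : {xs : List (X (V ⊕ •))} (z : X W) → Distinct xs → Distinct (concatMap (_∙ z) xs)
    bindˡ-distinct z = concatMap-distinct (basis _) (basis _) (_∙ z) (λ x → B.∙-unique x z)
      (λ i j → proj₁ (B.∙-injective i j))

    bindʳ-distinct : (x : X (V ⊕ •)) {ys : List (X W)} → Distinct ys → Distinct (concatMap (x ∙_) ys)
    bindʳ-distinct x = concatMap-distinct (basis _) (basis _) (x ∙_) (B.∙-unique x)
      (λ i j → proj₂ (B.∙-injective i j))

    summand-cong : {x x′ : X (V ⊕ •)} {y y′ : X W} → x ≈ᵇ x′ → y ≈ᵇ y′ → _≋_ (basis (V ⊕ W)) (∑ _ (x ∙ y)) (∑ _ (x′ ∙ y′))
    summand-cong p q = ∑-cong (B.∙-unique _ _) (B.∙-unique _ _) (B.∙-cong p q) (B.∙-cong (S.sym p) (S.sym q))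

    map-linear : (σ : V ≅ W) → IsLinear (free (basis V)) (free (basis W)) (map σ)
    map-linear σ = extend-linear (λ e → []-cong (B.rename-cong σ e))

    ∘*-linearˡ : (b : Free (basis W)) → IsLinear (free (basis (V ⊕ •))) (free (basis (V ⊕ W))) (_∘* b)
    ∘*-linearˡ b = extend-linear (λ p → extend-ext (λ y → summand-cong p S.refl) b)

    ∘*-linearʳ : (a : Free (basis (V ⊕ •))) → IsLinear (free (basis W)) (free (basis (V ⊕ W))) (a ∘*_)
    ∘*-linearʳ a = linear (free (basis _)) (free (basis _))
      (λ p → extend-ext (λ x → extend-cong (λ q → summand-cong S.refl q) p) a)
      (λ b b′ → extend-⊞ _ _ a)
      (extend-𝟎 a)
      (λ b → extend-· _ _ a)
      (λ k b → extend-· k _ a)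

    infixr 5 _⟫_
    _⟫_ : {X Y Z : Setoid 0ℓ 0ℓ} {f : Free X → Free Y} {g : Free Y → Free Z} →
          IsLinear (free X) (free Y) f → IsLinear (free Y) (free Z) g → IsLinear (free X) (free Z) (λ x → g (f x))
    p ⟫ q = Composition.isModuleHomomorphism ≋-trans p q

    map-∑ : (σ : V ≅ W) (xs : List (X V)) → _≋_ (basis W) (map σ (∑ _ xs)) (∑ _ (List.map (rename σ) xs))
    map-∑ σ = extend-∑-map (rename σ)

    ∘*-∑ˡ : (xs : List (X (V ⊕ •))) (z : X W) → _≋_ (basis (V ⊕ W)) (∑ _ xs ∘* [ z ]) (∑ _ (concatMap (_∙ z) xs))
    ∘*-∑ˡ xs z = extend-∑ (_∙ z) xs

    ∘*-∑ʳ : (x : X (V ⊕ •)) (ys : List (X W)) → _≋_ (basis (V ⊕ W)) ([ x ] ∘* ∑ _ ys) (∑ _ (concatMap (x ∙_) ys))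
    ∘*-∑ʳ x ys = extend-∑ (x ∙_) ys

    map-cong : (σ : V ≅ W) {a b : Free (basis V)} → _≋_ (basis V) a b → _≋_ (basis W) (map σ a) (map σ b)
    map-cong σ = extend-cong (λ e → []-cong (B.rename-cong σ e))

    ∘*-congˡ : {a b : Free (basis (V ⊕ •))} {d : Free (basis W)} → _≋_ (basis (V ⊕ •)) a b → _≋_ (basis (V ⊕ W)) (a ∘* d) (b ∘* d)
    ∘*-congˡ {d = d} = extend-cong (λ p → extend-ext (λ y → summand-cong p S.refl) d)

    natural : (σ : V ≅ V′) (τ : W ≅ W′) (x : X (V ⊕ •)) (y : X W) →
              _≋_ (basis (V′ ⊕ W′)) (map (σ ⊕ᵇ τ) ([ x ] ∘* [ y ])) (map (σ ⊕ᵇ idᵇ) [ x ] ∘* map τ [ y ])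
    natural {V} {V′} {W} {W′} σ τ x y = ≋-trans (map-∑ (σ ⊕ᵇ τ) (x ∙ y))
      (∑-cong (map-distinct (σ ⊕ᵇ τ) (B.∙-unique x y)) (B.∙-unique _ _)
        (λ {t} i → ∈-resp′ (cancel (σ ⊕ᵇ τ) (σ ⁻¹ ⊕ᵇ τ ⁻¹) inv t)
                   (B.∙-natural σ τ (∈-map⁻ (σ ⊕ᵇ τ) (σ ⁻¹ ⊕ᵇ τ ⁻¹) inv⁻ i)))
        (λ {t} i → ∈-map⁺ (σ ⊕ᵇ τ) (σ ⁻¹ ⊕ᵇ τ ⁻¹) inv (B.∙-cong
          (cancel (σ ⁻¹ ⊕ᵇ idᵇ) (σ ⊕ᵇ idᵇ) (λ { (inj₁ v) → cong inj₁ (strictlyInverseʳ σ v) ; (inj₂ _) → refl }) x)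
          (cancel (τ ⁻¹) τ (strictlyInverseʳ τ) y)
          (B.∙-natural (σ ⁻¹) (τ ⁻¹) i))))
      where
      inv : ∀ w → to (σ ⊕ᵇ τ) (to (σ ⁻¹ ⊕ᵇ τ ⁻¹) w) ≡ w
      inv (inj₁ w) = cong inj₁ (strictlyInverseˡ σ w)
      inv (inj₂ w) = cong inj₂ (strictlyInverseˡ τ w)
      inv⁻ : ∀ w → to (σ ⁻¹ ⊕ᵇ τ ⁻¹) (to (σ ⊕ᵇ τ) w) ≡ w
      inv⁻ (inj₁ w) = cong inj₁ (strictlyInverseʳ σ w)
      inv⁻ (inj₂ w) = cong inj₂ (strictlyInverseʳ τ w)

    sequential : (x : X (V ⊕ •)) (y : X (W ⊕ •)) (z : X Z) →
                 _≋_ (basis (V ⊕ (W ⊕ Z))) (map assocᵇ (map (assocᵇ ⁻¹) ([ x ] ∘* [ y ]) ∘* [ z ])) ([ x ] ∘* ([ y ] ∘* [ z ]))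
    sequential {V} {W} {Z} x y z = ≋-trans
      (map-cong assocᵇ (≋-trans (∘*-congˡ (map-∑ (assocᵇ ⁻¹) (x ∙ y))) (∘*-∑ˡ (List.map (rename (β ⁻¹)) (x ∙ y)) z)))
      (≋-trans (map-∑ assocᵇ L)
      (≋-trans (∑-cong
        (map-distinct assocᵇ (bindˡ-distinct z (map-distinct (assocᵇ ⁻¹) (B.∙-unique x y))))
        (bindʳ-distinct x (B.∙-unique y z))
        forth back)
      (≋-sym (∘*-∑ʳ x (y ∙ z)))))
      where
      α : (V ⊕ W) ⊕ Z ≅ V ⊕ (W ⊕ Z)
      α = assocᵇ
      β : (V ⊕ W) ⊕ • ≅ V ⊕ (W ⊕ •)
      β = assocᵇ
      L = concatMap (_∙ z) (List.map (rename (β ⁻¹)) (x ∙ y))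
      forth : ∀ {t} → t ∈ List.map (rename α) L → t ∈ concatMap (x ∙_) (y ∙ z)
      forth {t} i =
        let s , j , k = ∈-bind⁻ (_∙ z) (∈-map⁻ α (α ⁻¹) (strictlyInverseʳ α) i)
            r , j′ , k′ = B.∙-assoc⁺ x y z (∈-map⁻ (β ⁻¹) β (strictlyInverseˡ β) j)
                            (B.∙-cong (S.sym (cancel (β ⁻¹) β (strictlyInverseʳ β) s)) S.refl k)
        in ∈-bind⁺ (x ∙_) (λ e → B.∙-cong S.refl e) j′ (∈-resp′ (cancel α (α ⁻¹) (strictlyInverseˡ α) t) k′)
      back : ∀ {t} → t ∈ concatMap (x ∙_) (y ∙ z) → t ∈ List.map (rename α) L
      back {t} i =
        let r , j , k = ∈-bind⁻ (x ∙_) i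
            s , j′ , k′ = B.∙-assoc⁻ x y z j k
        in ∈-map⁺ α (α ⁻¹) (strictlyInverseˡ α) (∈-bind⁺ (_∙ z) (λ e → B.∙-cong e S.refl)
             (∈-map⁺ (β ⁻¹) β (strictlyInverseʳ β) (∈-resp′ (S.sym (cancel β (β ⁻¹) (strictlyInverseˡ β) s)) j′)) k′)

    exchanged : X ((V ⊕ •) ⊕ •) → X W → X Z → List (X ((V ⊕ W) ⊕ Z))
    exchanged x y z = concatMap (_∙ z) (List.map (rename exchangeᵇ) (x ∙ y))

    exchanged-distinct : (x : X ((V ⊕ •) ⊕ •)) (y : X W) (z : X Z) → Distinct (exchanged x y z)
    exchanged-distinct x y z = bindˡ-distinct z (map-distinct exchangeᵇ (B.∙-unique x y))

    exchanged-∑ : (x : X ((V ⊕ •) ⊕ •)) (y : X W) (z : X Z) →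
                  _≋_ (basis ((V ⊕ W) ⊕ Z)) (map exchangeᵇ ([ x ] ∘* [ y ]) ∘* [ z ]) (∑ _ (exchanged x y z))
    exchanged-∑ x y z = ≋-trans (∘*-congˡ (map-∑ exchangeᵇ (x ∙ y))) (∘*-∑ˡ (List.map (rename exchangeᵇ) (x ∙ y)) z)

    exchange-forth : (x x′ : X ((V ⊕ •) ⊕ •)) (y : X W) (z : X Z) → rename exchangeᵇ x ≈ᵇ x′ →
                     ∀ {t} → t ∈ exchanged x y z → rename exchangeᵇ t ∈ exchanged x′ z y
    exchange-forth {V} {W} {Z} x x′ y z ex {t} i =
      let s , j , k = ∈-bind⁻ (_∙ z) i
          s₀ = rename exchangeᵇ s
          r , j′ , k′ = B.∙-exchange x y z {s₀} {t} (∈-map⁻ exchangeᵇ exchangeᵇ exchange-involutive j)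
                          (B.∙-cong (S.sym (cancel exchangeᵇ exchangeᵇ exchange-involutive s)) S.refl k)
      in ∈-bind⁺ (_∙ y) (λ e → B.∙-cong e S.refl)
           (∈-map⁺ exchangeᵇ exchangeᵇ exchange-involutive
             (∈-resp′ (S.sym (cancel exchangeᵇ exchangeᵇ exchange-involutive r)) (B.∙-cong ex S.refl j′))) k′

    parallel : (x : X ((V ⊕ •) ⊕ •)) (y : X W) (z : X Z) →
               _≋_ (basis ((V ⊕ W) ⊕ Z)) (map exchangeᵇ ([ x ] ∘* [ y ]) ∘* [ z ])
                                          (map exchangeᵇ (map exchangeᵇ (map exchangeᵇ [ x ] ∘* [ z ]) ∘* [ y ]))
    parallel x y z = ≋-trans (exchanged-∑ x y z) (≋-trans
      (∑-cong (exchanged-distinct x y z) (map-distinct exchangeᵇ (exchanged-distinct x′ z y))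
        (λ i → ∈-map⁺ exchangeᵇ exchangeᵇ exchange-involutive (exchange-forth x x′ y z S.refl i))
        (λ {t} i → ∈-resp′ (cancel exchangeᵇ exchangeᵇ exchange-involutive t)
          (exchange-forth x′ x z y (cancel exchangeᵇ exchangeᵇ exchange-involutive x)
            (∈-map⁻ exchangeᵇ exchangeᵇ exchange-involutive i))))
      (≋-sym (≋-trans (map-cong exchangeᵇ (exchanged-∑ x′ z y)) (map-∑ exchangeᵇ (exchanged x′ z y)))))
      where x′ = rename exchangeᵇ x

    single : ∀ {V} {xs : List (X V)} {x : X V} → Distinct xs → x ∈ xs → (∀ {t} → t ∈ xs → t ≈ᵇ x) →
             _≋_ (basis V) (∑ _ xs) [ x ]
    single {x = x} d i f = ≋-trans (∑-cong {ys = x ∷ []} d ([] ∷ []) (λ j → here (f j))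
      (λ { (here e) → ∈-resp′ (S.sym e) i })) (≋-trans (⊞-comm _ _) (⊞-identityˡ _))

    operad : Operad c (c ⊔ ℓ₁)
    operad = record
      { species = record
        { space      = λ V → free (basis V)
        ; map        = map
        ; map-linear = map-linear
        ; map-ext    = λ e → extend-ext (λ x → []-cong (B.rename-ext e x))
        ; map-id     = linear-ext (free (basis _)) (map-linear idᵇ) (identity (basis _)) (λ x → []-cong (B.rename-id x))
        ; map-∘      = λ σ τ → linear-ext (free (basis _)) (map-linear (σ ∘ᵇ τ)) (map-linear τ ⟫ map-linear σ)
                         (λ x → []-cong (B.rename-∘ σ τ x))
        }
      ; vanishing    = vanishing
      ; e            = λ V v → [ B.unit V v ]
      ; e-natural    = λ σ v w → []-cong (B.unit-natural σ v w)
      ; _∘*_         = _∘*_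
      ; ∘-linearˡ    = ∘*-linearˡ
      ; ∘-linearʳ    = ∘*-linearʳ
      ; ∘-natural    = λ σ τ a b → linear-ext (free (basis _))
          (∘*-linearˡ b ⟫ map-linear (σ ⊕ᵇ τ)) (map-linear (σ ⊕ᵇ idᵇ) ⟫ ∘*-linearˡ (map τ b))
          (λ x → linear-ext (free (basis _))
            (∘*-linearʳ [ x ] ⟫ map-linear (σ ⊕ᵇ τ)) (map-linear τ ⟫ ∘*-linearʳ (map (σ ⊕ᵇ idᵇ) [ x ]))
            (natural σ τ x) b) a
      ; ∘-sequential = λ a b d → linear-ext (free (basis _))
          (∘*-linearˡ b ⟫ map-linear (assocᵇ ⁻¹) ⟫ ∘*-linearˡ d ⟫ map-linear assocᵇ) (∘*-linearˡ (b ∘* d))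
          (λ x → linear-ext (free (basis _))
            (∘*-linearʳ [ x ] ⟫ map-linear (assocᵇ ⁻¹) ⟫ ∘*-linearˡ d ⟫ map-linear assocᵇ) (∘*-linearˡ d ⟫ ∘*-linearʳ [ x ])
            (λ y → linear-ext (free (basis _))
              (∘*-linearʳ (map (assocᵇ ⁻¹) ([ x ] ∘* [ y ])) ⟫ map-linear assocᵇ) (∘*-linearʳ [ y ] ⟫ ∘*-linearʳ [ x ])
              (sequential x y) d) b) a
      ; ∘-parallel   = λ a b d → linear-ext (free (basis _))
          (∘*-linearˡ b ⟫ map-linear exchangeᵇ ⟫ ∘*-linearˡ d)
          (map-linear exchangeᵇ ⟫ ∘*-linearˡ d ⟫ map-linear exchangeᵇ ⟫ ∘*-linearˡ b ⟫ map-linear exchangeᵇ)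
          (λ x → linear-ext (free (basis _))
            (∘*-linearʳ [ x ] ⟫ map-linear exchangeᵇ ⟫ ∘*-linearˡ d)
            (∘*-linearʳ (map exchangeᵇ (map exchangeᵇ [ x ] ∘* d)) ⟫ map-linear exchangeᵇ)
            (λ y → linear-ext (free (basis _))
              (∘*-linearʳ (map exchangeᵇ ([ x ] ∘* [ y ])))
              (∘*-linearʳ (map exchangeᵇ [ x ]) ⟫ map-linear exchangeᵇ ⟫ ∘*-linearˡ [ y ] ⟫ map-linear exchangeᵇ)
              (parallel x y) d) b) a
      ; ∘-unitˡ      = λ v → linear-ext (free (basis _))
          (∘*-linearʳ [ B.unit (∅ ⊕ •) v ] ⟫ map-linear identityˡᵇ) (identity (basis _))
          (λ y → ≋-trans
            (map-cong identityˡᵇ (single (B.∙-unique _ y) (B.∙-unitˡ⁺ v y) (B.∙-unitˡ⁻ v y)))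
            ([]-cong (cancel identityˡᵇ (identityˡᵇ ⁻¹) (λ _ → refl) y)))
      ; ∘-unitʳ      = λ w → linear-ext (free (basis _))
          (∘*-linearˡ [ B.unit _ w ]) (map-linear (idᵇ ⊕ᵇ singletonᵇ w))
          (λ x → single (B.∙-unique x _) (B.∙-unitʳ⁺ w x) (B.∙-unitʳ⁻ w x))
      }
      where
      identity : (X : Setoid 0ℓ 0ℓ) → IsLinear (free X) (free X) id
      identity X = linear (free X) (free X) id (λ _ _ → ≋-refl) ≋-refl (λ _ → ≋-refl) (λ _ _ → ≋-refl)

      vanishing : ¬ ∣ V ∣ → (a : Free (basis V)) → _≋_ (basis V) a 𝟎
      vanishing n 𝟎       = ≋-refl
      vanishing n (a ⊞ b) = ≋-trans (⊞-cong (vanishing n a) (vanishing n b)) (⊞-identityˡ 𝟎)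
      vanishing n (k · a) = ≋-trans (·-cong R.refl (vanishing n a)) (·-zeroʳ k)
      vanishing n [ x ]   = ⊥-elim (n (B.inhabited x))

  𝕋 : Operad c (c ⊔ ℓ₁)
  𝕋 = Linearisation.operad treeBasisOperad

  PLie : Operad c (c ⊔ ℓ₁)
  PLie = Linearisation.operad rootedTreeBasisOperad

  ψ : ∀ V → Free (treeSetoid V) → Free (rootedTreeSetoid V)
  ψ V = extend (λ t → ∑ (rootedTreeSetoid V) (List.map (rooted t) (elements V)))

{-# OPTIONS --safe #-}
-- A pair of an attachment f for t₁ ∘ t₂ and a root r of the grafted tree
-- determines roots r₁, r₂ for which f respects the composition of PLie: if r lies
-- in t₂, take r₁ = * and r₂ = r; otherwise r₁ = r, and r₂ is the vertex to which f
-- attaches the parent of * with respect to r.  So both sides of the composition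
-- law are sums, without repetitions, over the same rooted trees.  For injectivity,
-- fix a vertex r₀ of V: sending (t , r₀) to t and all other rooted trees to 0 is a
-- left inverse of ψ.  Unlike forgetting the root, this needs no division by ∣V∣,
-- which a Heyting field of characteristic 0 need not allow: there, x ≉ 0 does not
-- make x invertible.
module Submission where

open import Algebra.Apartness.Bundles using (HeytingField)
open import Data.Empty using (⊥-elim)
open import Data.List.Base as List using (List; []; _∷_; concatMap)
open import Data.List.Relation.Unary.All using (All; []; _∷_)
import Data.List.Relation.Unary.All.Properties as AllP
open import Data.List.Relation.Unary.AllPairs as AllPairs using (AllPairs; []; _∷_)
import Data.List.Relation.Unary.AllPairs.Properties as AllPairsP
open import Data.List.Relation.Unary.Any as Any using (Any; here; there)
import Data.List.Relation.Unary.Any.Properties as AnyP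
open import Data.List.Relation.Unary.Unique.Propositional using (Unique)
open import Data.Product.Base using (_×_; _,_; proj₁; proj₂; ∃-syntax)
open import Data.Sum.Base using (inj₁; inj₂)
open import Data.Unit.Base using (tt)
open import Function.Definitions using (Injective)
open import Relation.Binary.PropositionalEquality.Core using (_≡_; _≢_; refl; sym; trans)
open import Relation.Nullary.Decidable.Core using (Dec; yes; no)
open import Relation.Nullary.Negation.Core using (¬_)
open import Defs

open RootedTree using (tree; root)

private variable
  V W : FinSet

infix 4 _∈ᴿ_
_∈ᴿ_ : RootedTree V → List (RootedTree V) → Set
t ∈ᴿ ts = Any (t ≈ᴿ_) ts

rootings : Tree V → List (RootedTree V)
rootings {V} t = List.map (rooted t) (elements V)

rootings-distinct : (t : Tree V) → AllPairs (λ x y → ¬ (x ≈ᴿ y)) (rootings t)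
rootings-distinct {V} t = AllPairsP.map⁺ (AllPairs.map (λ r≢s e → r≢s (proj₂ e)) (elements-unique V))

∈-rootings⁺ : (t : RootedTree V) {s : Tree V} → tree t ≈ᵀ s → t ∈ᴿ rootings s
∈-rootings⁺ {V} t e = AnyP.map⁺ (Any.map (e ,_) (elements-complete V (root t)))

∈-rootings⁻ : {t : RootedTree V} {s : Tree V} → t ∈ᴿ rootings s → tree t ≈ᵀ s
∈-rootings⁻ i = proj₁ (proj₂ (Any.satisfied (AnyP.map⁻ i)))

module _ {V W} (x : Tree (V ⊕ •)) (y : Tree W) where

  rootings-∘ᵀ : List (RootedTree (V ⊕ W))
  rootings-∘ᵀ = concatMap rootings (x ∘ᵀ y)

  rootings-∘ᴿ : List (RootedTree (V ⊕ W))
  rootings-∘ᴿ = concatMap (λ x• → concatMap (x• ∘ᴿ_) (rootings y)) (rootings x)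

  -- If the root of `x` is `*`, then `*` has no parent and consistency is vacuous. Otherwise
  -- `parent-unique` reduces consistency to a single equation, and taking `r₂` to be the value of
  -- `f` at the parent solves it.
  consistent-roots : (f : Attachment x W) (r : ∣ V ⊕ W ∣) →
                     ∃[ r₁ ] ∃[ r₂ ] Consistent {W = W} x r₁ r₂ f × r ≡ graftRoot r₁ r₂
  consistent-roots f (inj₂ w) = inj₂ tt , w , (λ _ ()) , refl
  consistent-roots f (inj₁ v) with parent-exists x v
  ... | u , p = inj₁ v , f u (parent-adjacent x (inj₁ v) p) , (λ _ q → same (parent-unique x (inj₁ v) q p) q) , refl
    where
    -- Attachments ignore the proof of adjacency, so equality of the two parents is enough.
    same : ∀ {u′} → u′ ≡ u → (q : Parent x (inj₁ v) u′) →
           f u′ (parent-adjacent x (inj₁ v) q) ≡ f u (parent-adjacent x (inj₁ v) p)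
    same refl q = refl

  rootings-∘⁺ : ∀ {t} → t ∈ᴿ rootings-∘ᵀ → t ∈ᴿ rootings-∘ᴿ
  rootings-∘⁺ {rooted t r} i with find (treeSetoid _) (AnyP.concatMap⁻ rootings {xs = x ∘ᵀ y} i)
  ... | s , s∈ , t∈ with ∈ᵀ⁻ x y {s} s∈
  ... | f , e with consistent-roots f r
  -- The roots `r₁` and `r₂` select the summand; the enumerations of `V ⊕ •` and `W` locate it in
  -- the double sum.
  ... | r₁ , r₂ , c , r≡ = AnyP.concatMap⁺ _ (AnyP.map⁺ (Any.map
    (λ { refl → AnyP.concatMap⁺ _ (AnyP.map⁺ (Any.map
      (λ { refl → ∈ᴿ⁺ (rooted x r₁) (rooted y r₂) {rooted t r} f c ((λ u v → trans (t≈s u v) (e u v)) , r≡) })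
      (elements-complete W r₂))) })
    (elements-complete (V ⊕ •) r₁)))
    where
    t≈s : t ≈ᵀ s
    t≈s = ∈-rootings⁻ {t = rooted t r} {s} t∈

  -- Both compositions graft along attachments, so consistency and the roots can be forgotten: every
  -- root of a grafted tree occurs in its `rootings`.
  rootings-∘⁻ : ∀ {t} → t ∈ᴿ rootings-∘ᴿ → t ∈ᴿ rootings-∘ᵀ
  rootings-∘⁻ {t} i with Any.satisfied (AnyP.map⁻ (AnyP.concatMap⁻ _ {xs = rootings x} i))
  ... | r₁ , j with Any.satisfied (AnyP.map⁻ (AnyP.concatMap⁻ _ {xs = rootings y} j))
  ... | r₂ , k with ∈ᴿ⁻ (rooted x r₁) (rooted y r₂) {t} k
  ... | f , _ , e , _ = AnyP.concatMap⁺ _ (Any.map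
    (λ {s} → ∈-rootings⁺ t {s})
    (∈ᵀ⁺ x y {tree t} f e))

  -- A rooted tree determines its underlying tree, so different trees have disjoint lists of
  -- rootings.
  rootings-∘ᵀ-distinct : AllPairs (λ s t → ¬ (s ≈ᴿ t)) rootings-∘ᵀ
  rootings-∘ᵀ-distinct = concatMap-distinct (treeSetoid _) (rootedTreeSetoid _) rootings rootings-distinct
    (λ {s} {s′} {t} i j u v → trans
      (sym (∈-rootings⁻ {t = t} {s} i u v)) (∈-rootings⁻ {t = t} {s′} j u v))
    (∘ᵀ-unique x y)

module _ {c ℓ₁ ℓ₂} (K : HeytingField c ℓ₁ ℓ₂) where

  private
    module 𝕃 = Linearisation K treeBasisOperad
    module ℝ = Linearisation K rootedTreeBasisOperad

    Tr : FinSet → Set c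
    Tr V = Free K (treeSetoid V)

    RTr : FinSet → Set c
    RTr V = Free K (rootedTreeSetoid V)

    infix 4 _≋ᵀ_ _≋ᴿ_
    _≋ᵀ_ : Tr V → Tr V → Set _
    _≋ᵀ_ {V} = _≋_ K (treeSetoid V)

    _≋ᴿ_ : RTr V → RTr V → Set _
    _≋ᴿ_ {V} = _≋_ K (rootedTreeSetoid V)

    ∑ᴿ : List (RootedTree V) → RTr V
    ∑ᴿ {V} = ∑ K (rootedTreeSetoid V)

  rootings-cong : {s t : Tree V} → s ≈ᵀ t → ∑ᴿ (rootings s) ≋ᴿ ∑ᴿ (rootings t)
  rootings-cong {V} {s} {t} e = ∑-cong K (rootings-distinct s) (rootings-distinct t)
    (λ {x} i → ∈-rootings⁺ x {t} λ u v → trans (∈-rootings⁻ {t = x} {s} i u v) (e u v))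
    (λ {x} i → ∈-rootings⁺ x {s} λ u v → trans (∈-rootings⁻ {t = x} {t} i u v) (sym (e u v)))

  ψ-linear : ∀ V → IsLinear K (free K (treeSetoid V)) (free K (rootedTreeSetoid V)) (ψ K V)
  ψ-linear V = extend-linear K λ {s} {t} → rootings-cong {s = s} {t}

  -- Relabelling may enumerate the roots in another order, so the two lists are compared as sets by
  -- `∑-cong` and not term by term.
  ψ-natural : (σ : V ≅ W) (t : Tree V) →
              ∑ᴿ (rootings (relabel σ t)) ≋ᴿ ℝ.map σ (∑ᴿ (rootings t))
  ψ-natural σ t = ≋-trans
    (∑-cong K (rootings-distinct (relabel σ t)) (ℝ.map-distinct σ (rootings-distinct t))
      (λ {x} i → ℝ.∈-map⁺ σ (σ ⁻¹) (strictlyInverseˡ σ) {x} (∈-rootings⁺ (relabelᴿ (σ ⁻¹) x) {t}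
        λ u v → trans (∈-rootings⁻ {t = x} {relabel σ t} i (to σ u) (to σ v)) (back u v)))
      (λ {x} i → ∈-rootings⁺ x {relabel σ t} λ u v → trans
        (sym (proj₁ (ℝ.cancel σ (σ ⁻¹) (strictlyInverseˡ σ) x) u v))
        (∈-rootings⁻ {t = relabelᴿ (σ ⁻¹) x} {t} (ℝ.∈-map⁻ σ (σ ⁻¹) (strictlyInverseʳ σ) {x} i) (from σ u) (from σ v))))
    (≋-sym (ℝ.map-∑ σ (rootings t)))
    where
    back : relabel (σ ⁻¹) (relabel σ t) ≈ᵀ t
    back = 𝕃.cancel (σ ⁻¹) σ (strictlyInverseʳ σ) t

  ψ-unit : (v : Singleton V) → ∑ᴿ (rootings (vertex V v)) ≋ᴿ [ vertexᴿ V v ]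
  ψ-unit {V} v = ℝ.single (rootings-distinct (vertex V v))
    (∈-rootings⁺ (vertexᴿ V v) {vertex V v} (λ _ _ → refl))
    (λ {t} i → ∈-rootings⁻ {t = t} {vertex V v} i , proj₂ v (root t))

  ψ-∘ : (x : Tree (V ⊕ •)) (y : Tree W) →
        ψ K (V ⊕ W) ([ x ] 𝕃.∘* [ y ]) ≋ᴿ ∑ᴿ (rootings x) ℝ.∘* ∑ᴿ (rootings y)
  ψ-∘ x y = ≋-trans (extend-∑ K rootings (x ∘ᵀ y)) (≋-trans
    (∑-cong K (rootings-∘ᵀ-distinct x y) distinct
      (λ {t} → rootings-∘⁺ x y {t}) (λ {t} → rootings-∘⁻ x y {t}))
    (≋-sym (≋-trans
      -- For each rooting of `x`, the sum over the roots of `y` is expanded first.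
      (extend-ext K (λ x• → ℝ.∘*-∑ʳ x• (rootings y)) (∑ᴿ (rootings x)))
      (extend-∑ K _ (rootings x)))))
    where
    -- A summand of a composition in `PLie` determines both factors, hence both roots, so no rooted
    -- tree arises twice and all coefficients are 1.
    distinct : ℝ.Distinct (rootings-∘ᴿ x y)
    distinct = concatMap-distinct (rootedTreeSetoid _) (rootedTreeSetoid _) _
      (λ x• → ℝ.bindʳ-distinct x• (rootings-distinct y))
      (λ {x•} {x•′} {t} i j →
        let r , i′ = Any.satisfied (AnyP.map⁻ (AnyP.concatMap⁻ (x• ∘ᴿ_) {xs = rootings y} i))
            s , j′ = Any.satisfied (AnyP.map⁻ (AnyP.concatMap⁻ (x•′ ∘ᴿ_) {xs = rootings y} j))
        in proj₁ (ℝ.B.∙-injective {x = x•} {x•′} {rooted y r} {rooted y s} {t} i′ j′))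
      (rootings-distinct x)

  module _ (r₀ : ∣ V ∣) where

    private
      open FinSet V using (_≟_)

      keep : {r : ∣ V ∣} → Dec (r ≡ r₀) → Tree V → Tr V
      keep (yes _) t = [ t ]
      keep (no _)  t = 𝟎

    atRoot : RootedTree V → Tr V
    atRoot (rooted t r) = keep (r ≟ r₀) t

    atRoot-cong : ∀ {s t} → s ≈ᴿ t → atRoot s ≋ᵀ atRoot t
    atRoot-cong {rooted s r} (e , refl) with r ≟ r₀
    ... | yes _ = []-cong e
    ... | no _  = ≋-refl

    unroot : RTr V → Tr V
    unroot = extend K atRoot

    private
      unroot-absent : ∀ t {rs} → All (r₀ ≢_) rs → unroot (∑ᴿ (List.map (rooted t) rs)) ≋ᵀ 𝟎
      unroot-absent t []                 = ≋-refl
      unroot-absent t (_∷_ {x = r} p ps) with r ≟ r₀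
      ... | yes e = ⊥-elim (p (sym e))
      ... | no _  = ≋-trans (⊞-identityˡ _) (unroot-absent t ps)

      -- Without repetitions, `r₀` occurs as a root exactly once, so `t` survives with coefficient
      -- 1.
      unroot-present : ∀ t {rs} → Unique rs → Any (r₀ ≡_) rs → unroot (∑ᴿ (List.map (rooted t) rs)) ≋ᵀ [ t ]
      unroot-present t (p ∷ d) (here refl) with r₀ ≟ r₀
      ... | yes _ = ≋-trans (⊞-cong ≋-refl (unroot-absent t p)) (≋-trans (⊞-comm _ _) (⊞-identityˡ _))
      ... | no n  = ⊥-elim (n refl)
      unroot-present t (_∷_ {x = r} p d) (there i) with r ≟ r₀
      ... | yes refl = ⊥-elim (AllP.All¬⇒¬Any p i)
      ... | no _  = ≋-trans (⊞-identityˡ _) (unroot-present t d i)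

    unroot-ψ : ∀ a → unroot (ψ K V a) ≋ᵀ a
    unroot-ψ 𝟎       = ≋-refl
    unroot-ψ (a ⊞ b) = ⊞-cong (unroot-ψ a) (unroot-ψ b)
    unroot-ψ (k · a) = ·-cong (HeytingField.refl K) (unroot-ψ a)
    unroot-ψ [ t ]   = unroot-present t (elements-unique V) (elements-complete V r₀)

    ψ-injective-at : Injective _≋ᵀ_ _≋ᴿ_ (ψ K V)
    ψ-injective-at {a} {b} e = ≋-trans (≋-sym (unroot-ψ a))
      (≋-trans (extend-cong K (λ {s} {t} → atRoot-cong {s} {t}) e) (unroot-ψ b))

  ψ-injective : ∀ V → Injective _≋ᵀ_ _≋ᴿ_ (ψ K V)
  ψ-injective V {a} {b} e = go (elements V) (elements-complete V)
    where
    go : ∀ vs → (∀ v → Any (v ≡_) vs) → a ≋ᵀ b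
    go (r₀ ∷ _) _        = ψ-injective-at r₀ e
    go []       complete = ≋-trans (Operad.vanishing (𝕋 K) empty a) (≋-sym (Operad.vanishing (𝕋 K) empty b))
      where
      empty : ¬ ∣ V ∣
      empty v with complete v
      ... | ()

proposition2p3 : ∀ {c ℓ₁ ℓ₂} (K : HeytingField c ℓ₁ ℓ₂) → CharacteristicZero K →
    IsOperadMonomorphism K (𝕋 K) (PLie K) (ψ K)
proposition2p3 K _ = record
  { isOperadMorphism = record
    { isLinear = ψ-linear K
    ; natural  = λ {V} {W} σ → linear-ext K (free K (rootedTreeSetoid W))
        (𝕃.map-linear σ 𝕃.⟫ ψ-linear K W) (ψ-linear K V 𝕃.⟫ ℝ.map-linear σ) (ψ-natural K σ)
    ; e-homo   = ψ-unit K
    -- Both sides are bilinear: first `a` is reduced to a tree `x` with `b` fixed, then `b` to a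
    -- tree.
    ; ∘-homo   = λ {V} {W} a b → linear-ext K (free K (rootedTreeSetoid (V ⊕ W)))
        (𝕃.∘*-linearˡ b 𝕃.⟫ ψ-linear K (V ⊕ W)) (ψ-linear K (V ⊕ •) 𝕃.⟫ ℝ.∘*-linearˡ (ψ K W b))
        (λ x → linear-ext K (free K (rootedTreeSetoid (V ⊕ W)))
          (𝕃.∘*-linearʳ [ x ] 𝕃.⟫ ψ-linear K (V ⊕ W)) (ψ-linear K W 𝕃.⟫ ℝ.∘*-linearʳ (∑ K _ (rootings x)))
          (ψ-∘ K x) b)
        a
    }
  ; injective = ψ-injective K
  }
  where
  module 𝕃 = Linearisation K treeBasisOperad
  module ℝ = Linearisation K rootedTreeBasisOperad
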